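{- Let $q=2^{s}$ with $s\ge 2$ and let $r=q+1$. Then there are at least $q+1$ pairwise non-isomorphic $(\{r,2r-3\};5)$-cages.
   Context: All graphs are finite, undirected and simple. The girth of a graph is the length of a shortest cycle. For integers $2\le r<m$, an $(\{r,m\};g)$-graph is a graph of girth exactly $g$ whose set of vertex degrees is exactly $\{r,m\}$, and an $(\{r,m\};g)$-cage is an $(\{r,m\};g)$-graph of minimum possible order. -}

module Defs where

open import Data.Fin.Base using (Fin; zero; suc; inject₁; fromℕ)
open import Data.List.Base using (length; filter; allFin)
open import Data.Nat.Base using (ℕ; suc; _≤_)
open import Data.Product.Base using (_×_; ∃-syntax)
open import Data.Sum.Base using (_⊎_)
open import Function.Bundles using (_↔_; _⇔_; Inverse)
open import Function.Definitions using (Injective)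
open import Level using (0ℓ)
open import Relation.Binary.Core using (Rel)
open import Relation.Binary.Definitions using (Symmetric; Irreflexive; Decidable)
open import Relation.Binary.PropositionalEquality using (_≡_)

-- Adjacency is required to be decidable, so that degrees can be counted;
-- classically this is no restriction.
record Graph : Set₁ where
  infix 4 _~_ _~?_
  field
    order  : ℕ
    _~_    : Rel (Fin order) 0ℓ
    _~?_   : Decidable _~_
    sym    : Symmetric _~_
    irrefl : Irreflexive _≡_ _~_

  Vertex : Set
  Vertex = Fin order

  degree : Vertex → ℕ
  degree v = length (filter (v ~?_) (allFin order))

open Graph using (order; Vertex; degree)

record Isomorphism (G H : Graph) : Set where
  private
    module G = Graph G
    module H = Graph H
  field
    bijection : G.Vertex ↔ H.Vertex

  open Inverse bijection public using (to)

  field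
    adjacency : ∀ u v → (u G.~ v) ⇔ (to u H.~ to v)

-- A cycle with suc k vertices, listed in cyclic order.
record CycleOn (G : Graph) (k : ℕ) : Set where
  open Graph G using (_~_)
  field
    3≤length : 3 ≤ suc k
    vertex   : Fin (suc k) → Vertex G
    distinct : Injective _≡_ _≡_ vertex
    step     : ∀ (i : Fin k) → vertex (inject₁ i) ~ vertex (suc i)
    close    : vertex (fromℕ k) ~ vertex zero

HasCycle : Graph → ℕ → Set
HasCycle G ℓ = ∃[ k ] (ℓ ≡ suc k × CycleOn G k)

HasGirth : Graph → ℕ → Set
HasGirth G g = HasCycle G g × (∀ ℓ → HasCycle G ℓ → g ≤ ℓ)

DegreeSetIs : Graph → ℕ → ℕ → Set
DegreeSetIs G r m = ∀ d → (∃[ v ] degree G v ≡ d) ⇔ (d ≡ r ⊎ d ≡ m)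

IsBiregular : (r m g : ℕ) → Graph → Set
IsBiregular r m g G = HasGirth G g × DegreeSetIs G r m

IsCage : (r m g : ℕ) → Graph → Set₁
IsCage r m g G =
  IsBiregular r m g G × (∀ H → IsBiregular r m g H → order G ≤ order H)

{-# OPTIONS --safe #-}

-- Take the incidence graph of an affine plane of order q = 2ˢ and add edges inside each of the q + 1
-- parallel classes of lines: either a star or a perfect matching. Parallel lines have no common point, so
-- no cycle of length 3 or 4 arises. Star centres get degree q + (q - 1) = 2r - 3, all other vertices q + 1 = r,
-- and the order 2q² + q meets the bound 1 + (2r - 3) r given by the ball of radius 2 around a vertex of
-- large degree. Choosing 1, …, q + 1 stars gives different numbers of vertices of large degree.
--
-- The plane comes from the field 𝔽₂[X]/(p) with p irreducible of degree s. Such p exists because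
-- X^(2ˢ) + X is squarefree of degree larger than the product of the X^(2ᵈ) + X for 0 < d < s: it has an
-- irreducible factor p not dividing that product. Fermat's little theorem in 𝔽₂[X]/(p) gives deg p ≥ s, and
-- counting the roots of X^(2ˢ) + X there gives deg p ≤ s.
module Submission where

open import Algebra.Bundles using (CommutativeMonoid; CommutativeRing; CommutativeSemiring; RawRing)
open import Algebra.Definitions.RawSemiring using (Irreducible; mkIrred)
import Algebra.Properties.CommutativeMonoid.Sum as CommutativeMonoidSum
import Algebra.Properties.CommutativeSemigroup as CommutativeSemigroupProperties
import Algebra.Properties.CommutativeSemiring.Exp as CommutativeSemiringExp
import Algebra.Properties.Semiring.Divisibility as SemiringDivisibility
import Algebra.Solver.Ring as RingSolver
open import Algebra.Solver.Ring.AlmostCommutativeRing using (fromCommutativeSemiring; _-Raw-AlmostCommutative⟶_)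
open import Data.Bool.Base using (Bool; true; false; _xor_; _∧_)
open import Data.Bool.Properties
  using (xor-∧-commutativeRing; xor-same; xor-assoc; xor-comm; xor-identityʳ; ∧-zeroʳ; ∧-distribˡ-xor; ∧-assoc; ∧-comm)
open import Data.Empty using (⊥; ⊥-elim)
open import Data.Fin.Base as Fin using (Fin; zero; suc; toℕ; fromℕ<; inject≤; opposite; punchIn; punchOut)
open import Data.Fin.Permutation using (Permutation′; permutation; _⟨$⟩ʳ_)
import Data.Fin.Properties as Fin
open import Data.List.Base as List using (List; []; _∷_; map; drop; filter; allFin; length)
import Data.List.Membership.Propositional.Properties as Membership
open import Data.List.Relation.Unary.All as All using ([]; _∷_)
import Data.List.Relation.Unary.All.Properties as All
open import Data.List.Relation.Unary.AllPairs using ([]; _∷_)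
import Data.List.Relation.Unary.Any as Any
open import Data.List.Relation.Unary.Any.Properties using (lookup-index)
open import Data.List.Relation.Unary.Unique.Propositional using (Unique)
import Data.List.Relation.Unary.Unique.Propositional.Properties as Unique
open import Data.Maybe.Base using (Maybe; just; nothing)
open import Data.Nat.Base as ℕ using (ℕ; zero; suc; s≤s; z≤n; _≤_; _<_)
import Data.Nat.Properties as ℕ
open import Data.Nat.Solver using (module +-*-Solver)
open import Data.Product.Base using (Σ; ∃; ∃₂; ∃-syntax; _×_; _,_; proj₁; proj₂)
import Data.Product.Properties as Product
open import Data.Sum.Base as Sum using (_⊎_; inj₁; inj₂; [_,_]′)
open import Data.Sum.Function.Propositional using (_⊎-↔_)
import Data.Sum.Properties as Sum
open import Data.Vec.Base as Vec using (Vec; []; _∷_)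
open import Data.Vec.Functional using (removeAt)
open import Defs
open import Function.Base using (id; _∘_)
open import Function.Bundles using (Equivalence; Injection; Inverse; _↔_; mk⇔)
open import Function.Definitions using (Injective; StrictlySurjective)
open import Function.Properties.Inverse using (↔⇒↣; ↔-sym; ↔-trans)
open import Level using (0ℓ)
open import Relation.Binary.Core using (Rel)
open import Relation.Binary.Definitions using (Irreflexive; Symmetric) renaming (Decidable to Decidable₂)
open import Relation.Binary.PropositionalEquality as ≡ using (_≡_; _≢_)
import Relation.Binary.Reasoning.Setoid as SetoidReasoning
open import Relation.Binary.Structures using (IsEquivalence)
open import Relation.Nullary.Decidable.Core using (Dec; yes; no; _×-dec_)
open import Relation.Nullary.Negation.Core using (¬_; contradiction)
open import Relation.Unary using (Decidable; Pred)

-- Finite domains of characteristic 2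

-- Inside a parallel class, any graph without triangles and without paths of three edges keeps the
-- girth at least 5. Stars and matchings are chosen for their degrees: q - 1 at the centre of a
-- star, 1 everywhere else. At least one star is present so that degree 2r - 3 occurs, which leaves
-- q + 1 possible numbers of stars. A matching of the q lines of a class requires q even; the
-- assumption s ≥ 2 gives q > 2, whereas for q = 2 the two degrees r and 2r - 3 coincide. The field
-- serves as a finite integral domain: cancellation shows that two lines of different classes share
-- at most one point, and counting the q² pairs shows that they share at least one. A residue ring
-- keeps the polynomials as its elements and only coarsens their equality, so all algebra takes
-- place in setoids.

injective⇒surjective : ∀ {n} {f : Fin n → Fin n} → Injective _≡_ _≡_ f → StrictlySurjective _≡_ f
injective⇒surjective {suc n} {f} f-inj y with Fin.any? (λ x → f x Fin.≟ y)
... | yes hit = hit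
... | no miss = contradiction (Fin.injective⇒≤ f∖y-injective) ℕ.1+n≰n
  where
  f∖y-injective : Injective _≡_ _≡_ (λ x → punchOut {i = y} (λ y≡fx → miss (x , ≡.sym y≡fx)))
  f∖y-injective eq = f-inj (Fin.punchOut-injective {i = y} _ _ eq)

injective⇒permutation : ∀ {n} {f : Fin n → Fin n} → Injective _≡_ _≡_ f →
                        ∃[ π ] (∀ i → π ⟨$⟩ʳ i ≡ f i)
injective⇒permutation {n} {f} f-inj = permutation f f⁻¹ f∘f⁻¹ (λ x → f-inj (f∘f⁻¹ (f x))) , λ _ → ≡.refl
  where
  f⁻¹ : Fin n → Fin n
  f⁻¹ y = proj₁ (injective⇒surjective f-inj y)
  f∘f⁻¹ : ∀ y → f (f⁻¹ y) ≡ y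
  f∘f⁻¹ y = proj₂ (injective⇒surjective f-inj y)

-- Negation is the identity in characteristic 2, so a semiring with x + x ≈ 0 is already a ring.
record 𝔽₂Algebra : Set₁ where
  field commutativeSemiring : CommutativeSemiring 0ℓ 0ℓ
  open CommutativeSemiring commutativeSemiring public hiding (zero)
  field x+x≈0 : ∀ x → x + x ≈ 0#

module 𝔽₂AlgebraProperties (A : 𝔽₂Algebra) where
  open 𝔽₂Algebra A
  open CommutativeSemiringExp commutativeSemiring public using (_^_; ^-congˡ; ^-assocʳ; ^-distrib-*)
  open SemiringDivisibility semiring public
    using (_∣_; _∤_; _,_; ∣-refl; ∣-trans; ∣-respʳ; ∣-respˡ; _∣0; x∣ʳy⇒x∣ʳzy)

  private
    -- Solver coefficients in 𝔽₂ make `x + x` normalise to zero, so that identities of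
    -- characteristic 2 are solved automatically.
    coefficients : RawRing 0ℓ 0ℓ
    coefficients = CommutativeRing.rawRing xor-∧-commutativeRing

    ⟦_⟧ᵇ : Bool → Carrier
    ⟦ false ⟧ᵇ = 0#
    ⟦ true ⟧ᵇ = 1#

    embedding : coefficients -Raw-AlmostCommutative⟶ fromCommutativeSemiring commutativeSemiring
    embedding = record
      { ⟦_⟧ = ⟦_⟧ᵇ
      ; +-homo = λ where
          false _     → sym (+-identityˡ _)
          true  false → sym (+-identityʳ _)
          true  true  → sym (x+x≈0 1#)
      ; *-homo = λ where
          false _ → sym (zeroˡ _)
          true  _ → sym (*-identityˡ _)
      ; -‿homo = λ _ → refl
      ; 0-homo = refl
      ; 1-homo = refl
      }

    _coeff≟_ : ∀ a b → Maybe (⟦ a ⟧ᵇ ≈ ⟦ b ⟧ᵇ)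
    false coeff≟ false = just refl
    false coeff≟ true  = nothing
    true  coeff≟ false = nothing
    true  coeff≟ true  = just refl

  module Solver = RingSolver coefficients (fromCommutativeSemiring commutativeSemiring) embedding _coeff≟_
  open Solver using (solve; _:+_; _:*_; _:^_; _:=_)

  x+y≈0⇒x≈y : ∀ {x y} → x + y ≈ 0# → x ≈ y
  x+y≈0⇒x≈y {x} {y} x+y≈0 =
    trans (solve 2 (λ x y → x := (x :+ y) :+ y) refl x y) (trans (+-congʳ x+y≈0) (+-identityˡ y))

  x≈y⇒x+y≈0 : ∀ {x y} → x ≈ y → x + y ≈ 0#
  x≈y⇒x+y≈0 {x} {y} x≈y = trans (+-congʳ x≈y) (x+x≈0 y)

  ∣-+ : ∀ {d x y} → d ∣ x → d ∣ y → d ∣ x + y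
  ∣-+ {d} (a , ad≈x) (b , bd≈y) = a + b , trans (distribʳ d a b) (+-cong ad≈x bd≈y)

  ∣-*ʳ : ∀ {d x} y → d ∣ x → d ∣ x * y
  ∣-*ʳ y d∣x = ∣-respʳ (*-comm y _) (x∣ʳy⇒x∣ʳzy y d∣x)

  ∣-+-cancelʳ : ∀ {d x y} → d ∣ x + y → d ∣ y → d ∣ x
  ∣-+-cancelʳ {d} {x} {y} d∣x+y d∣y =
    ∣-respʳ (solve 2 (λ x y → (x :+ y) :+ y := x) refl x y) (∣-+ d∣x+y d∣y)

  -- Squaring is additive because the cross term 2xy vanishes; the induction squares `x` and `y`
  -- first and then raises to the remaining power.
  frobenius : ∀ n x y → (x + y) ^ (2 ℕ.^ n) ≈ x ^ (2 ℕ.^ n) + y ^ (2 ℕ.^ n)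
  frobenius zero    x y = solve 2 (λ x y → (x :+ y) :^ 1 := x :^ 1 :+ y :^ 1) refl x y
  frobenius (suc n) x y = begin
    (x + y) ^ (2 ℕ.* N)             ≈⟨ ^-assocʳ (x + y) 2 N ⟨
    ((x + y) ^ 2) ^ N               ≈⟨ ^-congˡ N (solve 2 (λ x y → (x :+ y) :^ 2 := x :^ 2 :+ y :^ 2) refl x y) ⟩
    (x ^ 2 + y ^ 2) ^ N             ≈⟨ frobenius n (x ^ 2) (y ^ 2) ⟩
    (x ^ 2) ^ N + (y ^ 2) ^ N       ≈⟨ +-cong (^-assocʳ x 2 N) (^-assocʳ y 2 N) ⟩
    x ^ (2 ℕ.* N) + y ^ (2 ℕ.* N)   ∎
    where
    N : ℕ
    N = 2 ℕ.^ n
    open SetoidReasoning setoid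

  -- Writing 0 as 0 + 0, `frobenius` gives a sum of two equal terms.
  0^2^n≈0 : ∀ n → 0# ^ (2 ℕ.^ n) ≈ 0#
  0^2^n≈0 n = trans (^-congˡ (2 ℕ.^ n) (sym (+-identityˡ 0#))) (trans (frobenius n 0# 0#) (x+x≈0 _))

  1^n≈1 : ∀ n → 1# ^ n ≈ 1#
  1^n≈1 zero    = refl
  1^n≈1 (suc n) = trans (*-identityˡ _) (1^n≈1 n)

module Quotient (A : 𝔽₂Algebra) (p : 𝔽₂Algebra.Carrier A) where
  open 𝔽₂Algebra A
  open 𝔽₂AlgebraProperties A
  open Solver using (solve; _:+_; _:*_; _:=_)

  infix 4 _≈ₚ_
  -- In characteristic 2 the difference of `x` and `y` is their sum. Being a record, the relation
  -- lets unification recover `x` and `y`.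
  record _≈ₚ_ (x y : Carrier) : Set where
    constructor mod
    field p∣x+y : p ∣ x + y
  open _≈ₚ_ public

  ≈⇒≈ₚ : ∀ {x y} → x ≈ y → x ≈ₚ y
  ≈⇒≈ₚ x≈y = mod (∣-respʳ (sym (x≈y⇒x+y≈0 x≈y)) (p ∣0))

  p∣x⇒x≈ₚ0 : ∀ {x} → p ∣ x → x ≈ₚ 0#
  p∣x⇒x≈ₚ0 p∣x = mod (∣-respʳ (sym (+-identityʳ _)) p∣x)

  x≈ₚ0⇒p∣x : ∀ {x} → x ≈ₚ 0# → p ∣ x
  x≈ₚ0⇒p∣x (mod d) = ∣-respʳ (+-identityʳ _) d

  quotientAlgebra : 𝔽₂Algebra
  quotientAlgebra = record
    { commutativeSemiring = record
      { Carrier = Carrier ; _≈_ = _≈ₚ_ ; _+_ = _+_ ; _*_ = _*_ ; 0# = 0# ; 1# = 1#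
      ; isCommutativeSemiring = record
        { isSemiring = record
          { isSemiringWithoutAnnihilatingZero = record
            { +-isCommutativeMonoid = record
              { isMonoid = record
                { isSemigroup = record
                  { isMagma = record
                    { isEquivalence = ≈ₚ-isEquivalence
                    ; ∙-cong = λ {x} {y} {u} {v} (mod d) (mod e) → mod (∣-respʳ
                        (solve 4 (λ x y u v → (x :+ y) :+ (u :+ v) := (x :+ u) :+ (y :+ v)) refl x y u v) (∣-+ d e)) }
                  ; assoc = λ x y z → ≈⇒≈ₚ (+-assoc x y z) }
                ; identity = (λ x → ≈⇒≈ₚ (+-identityˡ x)) , (λ x → ≈⇒≈ₚ (+-identityʳ x)) }
              ; comm = λ x y → ≈⇒≈ₚ (+-comm x y) }
            ; *-cong = λ {x} {y} {u} {v} (mod d) (mod e) → mod (∣-respʳ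
                (solve 4 (λ x y u v → (x :+ y) :* u :+ (u :+ v) :* y := x :* u :+ y :* v) refl x y u v)
                (∣-+ (∣-*ʳ u d) (∣-*ʳ y e)))
            ; *-assoc = λ x y z → ≈⇒≈ₚ (*-assoc x y z)
            ; *-identity = (λ x → ≈⇒≈ₚ (*-identityˡ x)) , (λ x → ≈⇒≈ₚ (*-identityʳ x))
            ; distrib = (λ x y z → ≈⇒≈ₚ (distribˡ x y z)) , (λ x y z → ≈⇒≈ₚ (distribʳ x y z)) }
          ; zero = (λ x → ≈⇒≈ₚ (zeroˡ x)) , (λ x → ≈⇒≈ₚ (zeroʳ x)) }
        ; *-comm = λ x y → ≈⇒≈ₚ (*-comm x y) } }
    ; x+x≈0 = λ x → ≈⇒≈ₚ (x+x≈0 x)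
    }
    where
    ≈ₚ-isEquivalence : IsEquivalence _≈ₚ_
    ≈ₚ-isEquivalence = record
      { refl = ≈⇒≈ₚ refl
      ; sym = λ {x} {y} (mod d) → mod (∣-respʳ (+-comm x y) d)
      ; trans = λ {x} {y} {z} (mod d) (mod e) → mod (∣-respʳ
          (solve 3 (λ x y z → (x :+ y) :+ (y :+ z) := x :+ z) refl x y z) (∣-+ d e))
      }

  -- The two powers share their product but belong to different setoids; for a variable exponent
  -- they are identified by induction.
  ^-quotient : ∀ x n → 𝔽₂AlgebraProperties._^_ quotientAlgebra x n ≡ x ^ n
  ^-quotient x zero    = ≡.refl
  ^-quotient x (suc n) = ≡.cong (x *_) (^-quotient x n)

record IsDomain (A : 𝔽₂Algebra) : Set where
  open 𝔽₂Algebra A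
  field
    1≉0 : ¬ 1# ≈ 0#
    xy≈0⇒x≈0⊎y≈0 : ∀ {x y} → x * y ≈ 0# → x ≈ 0# ⊎ y ≈ 0#

module DomainProperties (A : 𝔽₂Algebra) (domain : IsDomain A) where
  open 𝔽₂Algebra A
  open 𝔽₂AlgebraProperties A
  open IsDomain domain
  open Solver using (solve; _:+_; _:*_; _:=_; con)
  open CommutativeMonoidSum *-commutativeMonoid using ()
    renaming (sum to product)

  *-cancelˡ : ∀ {x y z} → ¬ x ≈ 0# → x * y ≈ x * z → y ≈ z
  *-cancelˡ {x} {y} {z} x≉0 xy≈xz =
    [ (λ x≈0 → contradiction x≈0 x≉0) , x+y≈0⇒x≈y ]′
      (xy≈0⇒x≈0⊎y≈0 (trans (distribˡ x y z) (x≈y⇒x+y≈0 xy≈xz)))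

  product≉0 : ∀ {n} (t : Fin n → Carrier) → (∀ i → ¬ t i ≈ 0#) → ¬ product t ≈ 0#
  product≉0 {zero}  t t≉0 = 1≉0
  product≉0 {suc n} t t≉0 = [ t≉0 zero , product≉0 (t ∘ suc) (t≉0 ∘ suc) ]′ ∘ xy≈0⇒x≈0⊎y≈0

  -- The monic polynomial whose lower coefficients are cs.
  eval : ∀ {n} → Vec Carrier n → Carrier → Carrier
  eval []       x = 1#
  eval (c ∷ cs) x = c + x * eval cs x

  -- Horner's scheme: the value at `a` of the tail becomes the constant coefficient of the quotient,
  -- which is again monic.
  divideByRoot : ∀ {n} (cs : Vec Carrier (suc n)) a →
                 ∃[ ds ] (∀ x → eval cs x + eval cs a ≈ (x + a) * eval {n} ds x)
  divideByRoot {zero} (c ∷ []) a = [] , λ x →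
    solve 3 (λ c x a → (c :+ x :* con true) :+ (c :+ a :* con true) := (x :+ a) :* con true) refl c x a
  divideByRoot {suc n} (c ∷ cs) a with divideByRoot cs a
  ... | ds , factor = eval cs a ∷ ds , λ x → begin
    (c + x * eval cs x) + (c + a * eval cs a)
      ≈⟨ solve 5 (λ c x a Ex Ea → (c :+ x :* Ex) :+ (c :+ a :* Ea) := x :* (Ex :+ Ea) :+ (x :+ a) :* Ea)
           refl c x a (eval cs x) (eval cs a) ⟩
    x * (eval cs x + eval cs a) + (x + a) * eval cs a
      ≈⟨ +-congʳ (*-congˡ (factor x)) ⟩
    x * ((x + a) * eval ds x) + (x + a) * eval cs a
      ≈⟨ solve 4 (λ x a Q Ea → x :* ((x :+ a) :* Q) :+ (x :+ a) :* Ea := (x :+ a) :* (Ea :+ x :* Q))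
           refl x a (eval ds x) (eval cs a) ⟩
    (x + a) * (eval cs a + x * eval ds x) ∎
    where open SetoidReasoning setoid

  #roots≤degree : ∀ {m n} (cs : Vec Carrier n) (f : Fin m → Carrier) → Injective _≡_ _≈_ f →
                  (∀ i → eval cs (f i) ≈ 0#) → m ℕ.≤ n
  #roots≤degree {zero}          cs f f-inj root = z≤n
  #roots≤degree {suc m} {zero}  [] f f-inj root = contradiction (root zero) 1≉0
  #roots≤degree {suc m} {suc n} cs f f-inj root with divideByRoot cs (f zero)
  ... | ds , factor = s≤s (#roots≤degree ds (f ∘ suc) (Fin.suc-injective ∘ f-inj) root′)
    where
    root′ : ∀ i → eval ds (f (suc i)) ≈ 0#
    root′ i with xy≈0⇒x≈0⊎y≈0 (trans (sym (factor (f (suc i)))) (x≈y⇒x+y≈0 (trans (root (suc i)) (sym (root zero)))))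
    ... | inj₂ eq = eq
    ... | inj₁ eq with () ← f-inj (x+y≈0⇒x≈y eq)

  -- Fixed points are roots of the monic polynomial of degree `2 + k` with lower coefficients 0, 1,
  -- 0, ..., 0. The offset 2 keeps the linear term below the leading one.
  #fixedPoints≤exponent : ∀ {m} k (f : Fin m → Carrier) → Injective _≡_ _≈_ f →
                    (∀ i → f i ^ (2 ℕ.+ k) ≈ f i) → m ℕ.≤ 2 ℕ.+ k
  #fixedPoints≤exponent k f f-inj fixed = #roots≤degree (0# ∷ 1# ∷ zeros k) f f-inj λ i → begin
      0# + f i * (1# + f i * eval (zeros k) (f i)) ≈⟨ +-congˡ (*-congˡ (+-congˡ (*-congˡ (eval-zeros k (f i))))) ⟩
      0# + f i * (1# + f i * f i ^ k)
        ≈⟨ solve 2 (λ x y → con false :+ x :* (con true :+ x :* y) := x :* (x :* y) :+ x) refl (f i) (f i ^ k) ⟩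
      f i ^ (2 ℕ.+ k) + f i                        ≈⟨ x≈y⇒x+y≈0 (fixed i) ⟩
      0#                                           ∎
    where
    open SetoidReasoning setoid
    zeros : ∀ k → Vec Carrier k
    zeros k = Vec.replicate k 0#
    eval-zeros : ∀ k x → eval (zeros k) x ≈ x ^ k
    eval-zeros zero    x = refl
    eval-zeros (suc k) x = trans (+-identityˡ _) (*-congˡ (eval-zeros k x))

module FiniteDomainProperties (A : 𝔽₂Algebra) (domain : IsDomain A) {n : ℕ}
  (finite : Inverse (≡.setoid (Fin n)) (𝔽₂Algebra.setoid A)) where
  open 𝔽₂Algebra A
  open 𝔽₂AlgebraProperties A
  open IsDomain domain
  open DomainProperties A domain
  open Inverse finite using () renaming (to to element; from to index; from-cong to index-cong;
    strictlyInverseˡ to element-index; strictlyInverseʳ to index-element)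

  element-injective : ∀ {i j} → element i ≈ element j → i ≡ j
  element-injective {i} {j} eq =
    ≡.trans (≡.sym (index-element i)) (≡.trans (index-cong eq) (index-element j))

  index-injective : ∀ {x y} → index x ≡ index y → x ≈ y
  index-injective {x} {y} eq =
    trans (sym (element-index x)) (trans (reflexive (≡.cong element eq)) (element-index y))

  _≈?_ : ∀ x y → Dec (x ≈ y)
  x ≈? y with index x Fin.≟ index y
  ... | yes eq = yes (index-injective eq)
  ... | no neq = no (neq ∘ index-cong)

  private
    module FiniteProduct = CommutativeMonoidSum *-commutativeMonoid

    -- With 0 replaced by 1, a product over the whole carrier stands for the product of the nonzero
    -- elements.
    nonzeroPart : Carrier → Carrier
    nonzeroPart x with x ≈? 0#
    ... | yes _ = 1#
    ... | no  _ = x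

    nonzeroPart≉0 : ∀ x → ¬ nonzeroPart x ≈ 0#
    nonzeroPart≉0 x with x ≈? 0#
    ... | yes _   = 1≉0
    ... | no  x≉0 = x≉0

    nonzeroPart-cong : ∀ {x y} → x ≈ y → nonzeroPart x ≈ nonzeroPart y
    nonzeroPart-cong {x} {y} x≈y with x ≈? 0# | y ≈? 0#
    ... | yes _   | yes _   = refl
    ... | yes x≈0 | no  y≉0 = contradiction (trans (sym x≈y) x≈0) y≉0
    ... | no  x≉0 | yes y≈0 = contradiction (trans x≈y y≈0) x≉0
    ... | no  _   | no  _   = x≈y

    -- The factor by which `nonzeroPart` changes when `y` is multiplied by a nonzero `x`. Over all
    -- `n` elements `y` these factors multiply to the power n - 1 of `x`.
    scalingFactor : Carrier → Carrier → Carrier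
    scalingFactor x y with y ≈? 0#
    ... | yes _ = 1#
    ... | no  _ = x

    scalingFactor-zero : ∀ {x y} → y ≈ 0# → scalingFactor x y ≈ 1#
    scalingFactor-zero {x} {y} y≈0 with y ≈? 0#
    ... | yes _   = refl
    ... | no  y≉0 = contradiction y≈0 y≉0

    scalingFactor-nonzero : ∀ {x y} → ¬ y ≈ 0# → scalingFactor x y ≈ x
    scalingFactor-nonzero {x} {y} y≉0 with y ≈? 0#
    ... | yes y≈0 = contradiction y≈0 y≉0
    ... | no  _   = refl

    nonzeroPart-* : ∀ {x} y → ¬ x ≈ 0# → nonzeroPart (x * y) ≈ scalingFactor x y * nonzeroPart y
    nonzeroPart-* {x} y x≉0 with (x * y) ≈? 0# | y ≈? 0#
    ... | yes _    | yes _   = sym (*-identityˡ 1#)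
    ... | yes xy≈0 | no  y≉0 = contradiction (xy≈0⇒x≈0⊎y≈0 xy≈0) [ x≉0 , y≉0 ]′
    ... | no  xy≉0 | yes y≈0 = contradiction (trans (*-congˡ y≈0) (zeroʳ x)) xy≉0
    ... | no  _    | no  _   = refl

  -- Multiplication by x permutes the nonzero elements, so it does not change their product.
  fermat-nonzero : ∀ {k x} → n ≡ suc k → ¬ x ≈ 0# → x ^ k ≈ 1#
  fermat-nonzero {k} {x} ≡.refl x≉0 = *-cancelˡ (product≉0 units (λ i → nonzeroPart≉0 (element i))) (begin
    product units * x ^ k                   ≈⟨ *-comm _ _ ⟩
    x ^ k * product units                   ≈⟨ *-congʳ product-factors ⟨
    product factors * product units         ≈⟨ FiniteProduct.∑-distrib-+ factors units ⟨
    product (λ i → factors i * units i)     ≈⟨ FiniteProduct.sum-cong-≋ (λ i → permuted i) ⟨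
    product (λ i → units (π ⟨$⟩ʳ i))        ≈⟨ FiniteProduct.sum-permute units π ⟨
    product units                           ≈⟨ *-identityʳ _ ⟨
    product units * 1#                      ∎)
    where
    open SetoidReasoning setoid
    open FiniteProduct using () renaming (sum to product)
    units factors : Fin n → Carrier
    units i = nonzeroPart (element i)
    factors i = scalingFactor x (element i)
    scale : Fin n → Fin n
    scale i = index (x * element i)
    scale-injective : Injective _≡_ _≡_ scale
    scale-injective = element-injective ∘ *-cancelˡ x≉0 ∘ index-injective
    π : Permutation′ n
    π = proj₁ (injective⇒permutation scale-injective)
    permuted : ∀ i → units (π ⟨$⟩ʳ i) ≈ factors i * units i
    permuted i = trans (nonzeroPart-cong (element-index _)) (nonzeroPart-* (element i) x≉0)
    z : Fin n
    z = index 0#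
    product-factors : product factors ≈ x ^ k
    product-factors = begin
      product factors                       ≈⟨ FiniteProduct.sum-remove {i = z} factors ⟩
      factors z * product (removeAt factors z) ≈⟨ *-cong (scalingFactor-zero (element-index 0#))
                                                  (FiniteProduct.sum-cong-≋ (λ i → scalingFactor-nonzero (nonzero i))) ⟩
      1# * product {k} (λ _ → x)            ≈⟨ *-identityˡ _ ⟩
      product {k} (λ _ → x)                 ≈⟨ FiniteProduct.sum-replicate k ⟩
      x ^ k                                 ∎
      where
      nonzero : ∀ i → ¬ element (punchIn z i) ≈ 0#
      nonzero i eq = Fin.punchInᵢ≢i z i (≡.trans (≡.sym (index-element _)) (index-cong eq))

  fermat : ∀ x → x ^ n ≈ x
  fermat x = go n ≡.refl (x ≈? 0#)
    where
    go : ∀ m → n ≡ m → Dec (x ≈ 0#) → x ^ m ≈ x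
    go zero    n≡ _         = contradiction (≡.subst Fin n≡ (index 0#)) λ ()
    go (suc k) n≡ (yes x≈0) = trans (*-congʳ x≈0) (trans (zeroˡ _) (sym x≈0))
    go (suc k) n≡ (no  x≉0) = trans (*-congˡ (fermat-nonzero n≡ x≉0)) (*-identityʳ x)

-- The polynomial ring over 𝔽₂

module 𝔽₂[X] where

  -- Coefficients in increasing degree; trailing zeros are allowed.
  Polynomial : Set
  Polynomial = List Bool

  coeff : Polynomial → ℕ → Bool
  coeff []      _       = false
  coeff (a ∷ p) zero    = a
  coeff (a ∷ p) (suc n) = coeff p n

  infix 4 _≈_
  record _≈_ (p q : Polynomial) : Set where
    constructor pointwise
    field at : ∀ n → coeff p n ≡ coeff q n
  open _≈_ public

  infixl 6 _+_
  infixl 7 _*_ _·_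

  _·_ : Bool → Polynomial → Polynomial
  b · p = map (b ∧_) p

  ≈-isEquivalence : IsEquivalence _≈_
  ≈-isEquivalence = record
    { refl  = pointwise λ _ → ≡.refl
    ; sym   = λ e → pointwise λ n → ≡.sym (at e n)
    ; trans = λ e f → pointwise λ n → ≡.trans (at e n) (at f n)
    }
  open IsEquivalence ≈-isEquivalence using (refl; sym; trans)

  -- Opaque, so that unification can recover the operands of a sum or a product.
  opaque
    _+_ : Polynomial → Polynomial → Polynomial
    []      + q       = q
    (a ∷ p) + []      = a ∷ p
    (a ∷ p) + (b ∷ q) = (a xor b) ∷ (p + q)

    _*_ : Polynomial → Polynomial → Polynomial
    []      * q = []
    (a ∷ p) * q = a · q + (false ∷ p * q)

    coeff-+ : ∀ p q n → coeff (p + q) n ≡ coeff p n xor coeff q n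
    coeff-+ []      q       n       = ≡.refl
    coeff-+ (a ∷ p) []      zero    = ≡.sym (xor-identityʳ a)
    coeff-+ (a ∷ p) []      (suc n) = ≡.sym (xor-identityʳ _)
    coeff-+ (a ∷ p) (b ∷ q) zero    = ≡.refl
    coeff-+ (a ∷ p) (b ∷ q) (suc n) = coeff-+ p q n

  coeff-· : ∀ b p n → coeff (b · p) n ≡ b ∧ coeff p n
  coeff-· b []      n       = ≡.sym (∧-zeroʳ b)
  coeff-· b (a ∷ p) zero    = ≡.refl
  coeff-· b (a ∷ p) (suc n) = coeff-· b p n

  opaque
    unfolding _+_

    +-cong : ∀ {p p′ q q′} → p ≈ p′ → q ≈ q′ → p + q ≈ p′ + q′
    +-cong {p} {p′} {q} {q′} e f = pointwise λ n → begin
      coeff (p + q) n          ≡⟨ coeff-+ p q n ⟩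
      coeff p n xor coeff q n  ≡⟨ ≡.cong₂ _xor_ (at e n) (at f n) ⟩
      coeff p′ n xor coeff q′ n ≡⟨ coeff-+ p′ q′ n ⟨
      coeff (p′ + q′) n        ∎
      where open ≡.≡-Reasoning

    +-assoc : ∀ p q r → (p + q) + r ≈ p + (q + r)
    +-assoc p q r = pointwise λ n → begin
      coeff ((p + q) + r) n                     ≡⟨ coeff-+ (p + q) r n ⟩
      coeff (p + q) n xor coeff r n             ≡⟨ ≡.cong (_xor coeff r n) (coeff-+ p q n) ⟩
      (coeff p n xor coeff q n) xor coeff r n   ≡⟨ xor-assoc (coeff p n) _ _ ⟩
      coeff p n xor (coeff q n xor coeff r n)   ≡⟨ ≡.cong (coeff p n xor_) (coeff-+ q r n) ⟨
      coeff p n xor coeff (q + r) n             ≡⟨ coeff-+ p (q + r) n ⟨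
      coeff (p + (q + r)) n                     ∎
      where open ≡.≡-Reasoning

    +-comm : ∀ p q → p + q ≈ q + p
    +-comm p q = pointwise λ n →
      ≡.trans (coeff-+ p q n) (≡.trans (xor-comm (coeff p n) _) (≡.sym (coeff-+ q p n)))

    +-self : ∀ p → p + p ≈ []
    +-self p = pointwise λ n → ≡.trans (coeff-+ p p n) (xor-same (coeff p n))

    ∷-+ : ∀ a b p q → (a ∷ p) + (b ∷ q) ≈ (a xor b) ∷ (p + q)
    ∷-+ a b p q = refl

    +-identityˡ : ∀ p → [] + p ≈ p
    +-identityˡ p = refl

    +-identityʳ : ∀ p → p + [] ≈ p
    +-identityʳ []      = refl
    +-identityʳ (a ∷ p) = refl

  +-commutativeMonoid : CommutativeMonoid 0ℓ 0ℓ
  +-commutativeMonoid = record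
    { isCommutativeMonoid = record
      { isMonoid = record
        { isSemigroup = record
          { isMagma = record { isEquivalence = ≈-isEquivalence ; ∙-cong = +-cong }
          ; assoc = +-assoc }
        ; identity = +-identityˡ , +-identityʳ }
      ; comm = +-comm } }

  open CommutativeMonoid +-commutativeMonoid using (setoid) renaming (∙-congˡ to +-congˡ; ∙-congʳ to +-congʳ)
  open CommutativeSemigroupProperties (CommutativeMonoid.commutativeSemigroup +-commutativeMonoid)
    using (interchange; x∙yz≈y∙xz)

  ∷-cong : ∀ {a b p q} → a ≡ b → p ≈ q → a ∷ p ≈ b ∷ q
  ∷-cong e f = pointwise λ where
    zero    → e
    (suc n) → at f n

  opaque
    unfolding _+_

    *-zeroˡ : ∀ p → [] * p ≈ []
    *-zeroˡ p = refl

    ∷-* : ∀ a p q → (a ∷ p) * q ≈ a · q + (false ∷ p * q)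
    ∷-* a p q = refl

    ·-cong : ∀ b {p q} → p ≈ q → b · p ≈ b · q
    ·-cong b {p} {q} e = pointwise λ n →
      ≡.trans (coeff-· b p n) (≡.trans (≡.cong (b ∧_) (at e n)) (≡.sym (coeff-· b q n)))

    ·-distrib-+ : ∀ b p q → b · (p + q) ≈ b · p + b · q
    ·-distrib-+ b p q = pointwise λ n → begin
      coeff (b · (p + q)) n                     ≡⟨ coeff-· b (p + q) n ⟩
      b ∧ coeff (p + q) n                       ≡⟨ ≡.cong (b ∧_) (coeff-+ p q n) ⟩
      b ∧ (coeff p n xor coeff q n)             ≡⟨ ∧-distribˡ-xor b _ _ ⟩
      (b ∧ coeff p n) xor (b ∧ coeff q n)       ≡⟨ ≡.cong₂ _xor_ (coeff-· b p n) (coeff-· b q n) ⟨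
      coeff (b · p) n xor coeff (b · q) n       ≡⟨ coeff-+ (b · p) (b · q) n ⟨
      coeff (b · p + b · q) n                   ∎
      where open ≡.≡-Reasoning

    ·-assoc : ∀ a b p → (a ∧ b) · p ≈ a · (b · p)
    ·-assoc a b p = pointwise λ n → begin
      coeff ((a ∧ b) · p) n      ≡⟨ coeff-· (a ∧ b) p n ⟩
      (a ∧ b) ∧ coeff p n        ≡⟨ ∧-assoc a b _ ⟩
      a ∧ (b ∧ coeff p n)        ≡⟨ ≡.cong (a ∧_) (coeff-· b p n) ⟨
      a ∧ coeff (b · p) n        ≡⟨ coeff-· a (b · p) n ⟨
      coeff (a · (b · p)) n      ∎
      where open ≡.≡-Reasoning

    false· : ∀ p → false · p ≈ []
    false· p = pointwise (coeff-· false p)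

    true· : ∀ p → true · p ≈ p
    true· p = pointwise (coeff-· true p)

    false∷[] : false ∷ [] ≈ []
    false∷[] = pointwise λ where
      zero    → ≡.refl
      (suc n) → ≡.refl

    *-congˡ : ∀ p {q r} → q ≈ r → p * q ≈ p * r
    *-congˡ []      e = refl
    *-congˡ (a ∷ p) e = +-cong (·-cong a e) (∷-cong ≡.refl (*-congˡ p e))

    *-zeroʳ : ∀ p → p * [] ≈ []
    *-zeroʳ []      = refl
    *-zeroʳ (a ∷ p) = trans (∷-cong ≡.refl (*-zeroʳ p)) false∷[]

    -- The defining recursion of the product, mirrored to the second factor; commutativity then
    -- follows by induction.
    *-∷ : ∀ p b q → p * (b ∷ q) ≈ b · p + (false ∷ p * q)
    *-∷ []      b q = sym false∷[]
    *-∷ (a ∷ p) b q = ∷-cong (≡.cong (_xor false) (∧-comm a b))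
      (trans (+-congˡ (*-∷ p b q)) (x∙yz≈y∙xz (a · q) (b · p) _))

    *-comm : ∀ p q → p * q ≈ q * p
    *-comm []      q = sym (*-zeroʳ q)
    *-comm (a ∷ p) q = trans (+-congˡ (∷-cong ≡.refl (*-comm p q))) (sym (*-∷ q a p))

    *-cong : ∀ {p p′ q q′} → p ≈ p′ → q ≈ q′ → p * q ≈ p′ * q′
    *-cong {p} {p′} {q} {q′} e f =
      trans (*-congˡ p f) (trans (*-comm p q′) (trans (*-congˡ q′ e) (*-comm q′ p′)))

    *-distribˡ-+ : ∀ p q r → p * (q + r) ≈ p * q + p * r
    *-distribˡ-+ []      q r = refl
    *-distribˡ-+ (a ∷ p) q r = trans
      (+-cong (·-distrib-+ a q r) (∷-cong ≡.refl (*-distribˡ-+ p q r)))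
      (interchange (a · q) (a · r) (false ∷ p * q) (false ∷ p * r))

    *-distribʳ-+ : ∀ p q r → (q + r) * p ≈ q * p + r * p
    *-distribʳ-+ p q r = trans (*-comm (q + r) p)
      (trans (*-distribˡ-+ p q r) (+-cong (*-comm p q) (*-comm p r)))

    ·-* : ∀ b p q → (b · p) * q ≈ b · (p * q)
    ·-* b []      q = refl
    ·-* b (a ∷ p) q = trans
      (+-cong (·-assoc b a q) (∷-cong (≡.sym (∧-zeroʳ b)) (·-* b p q)))
      (sym (·-distrib-+ b (a · q) (false ∷ p * q)))

    false∷-* : ∀ p q → (false ∷ p) * q ≈ false ∷ p * q
    false∷-* p q = +-congʳ (false· q)

    *-assoc : ∀ p q r → (p * q) * r ≈ p * (q * r)
    *-assoc []      q r = refl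
    *-assoc (a ∷ p) q r = trans (*-distribʳ-+ r (a · q) (false ∷ p * q))
      (+-cong (·-* a q r) (trans (false∷-* (p * q) r) (∷-cong ≡.refl (*-assoc p q r))))

    *-identityˡ : ∀ p → (true ∷ []) * p ≈ p
    *-identityˡ p = trans (+-cong (true· p) false∷[]) (+-identityʳ p)

  algebra : 𝔽₂Algebra
  algebra = record
    { commutativeSemiring = record
      { Carrier = Polynomial ; _≈_ = _≈_ ; _+_ = _+_ ; _*_ = _*_ ; 0# = [] ; 1# = true ∷ []
      ; isCommutativeSemiring = record
        { isSemiring = record
          { isSemiringWithoutAnnihilatingZero = record
            { +-isCommutativeMonoid = CommutativeMonoid.isCommutativeMonoid +-commutativeMonoid
            ; *-cong = *-cong
            ; *-assoc = *-assoc
            ; *-identity = *-identityˡ , λ p → trans (*-comm p _) (*-identityˡ p)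
            ; distrib = *-distribˡ-+ , *-distribʳ-+ }
          ; zero = *-zeroˡ , *-zeroʳ }
        ; *-comm = *-comm } }
    ; x+x≈0 = +-self
    }

-- Degrees and division with remainder

module Polynomials where

  open 𝔽₂[X] using (Polynomial; coeff; at; pointwise; ∷-cong; ∷-+; ∷-*; false∷[]; false·; _·_; coeff-+; coeff-·)
  open 𝔽₂Algebra 𝔽₂[X].algebra
  open 𝔽₂AlgebraProperties 𝔽₂[X].algebra

  X : Polynomial
  X = false ∷ true ∷ []

  X* : ∀ p → X * p ≈ false ∷ p
  X* p = trans (∷-* false (true ∷ []) p)
    (trans (+-congʳ (false· p)) (trans (+-identityˡ _) (∷-cong ≡.refl (*-identityˡ p))))

  ∷-decompose : ∀ b p → b ∷ p ≈ (b ∷ []) + X * p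
  ∷-decompose b p = sym (trans (+-congˡ (X* p)) (trans (∷-+ b false [] p) (∷-cong (xor-identityʳ b) (+-identityˡ p))))

  -- deg p < n, where deg 0 = -∞
  record DegreeBelow (n : ℕ) (p : Polynomial) : Set where
    constructor below
    field vanishes : ∀ {k} → n ≤ k → coeff p k ≡ false
  open DegreeBelow

  record HasDegree (p : Polynomial) (d : ℕ) : Set where
    constructor hasDegree
    field
      leading : coeff p d ≡ true
      upper   : DegreeBelow (suc d) p
  open HasDegree

  DegreeBelow-resp : ∀ {n p q} → p ≈ q → DegreeBelow n p → DegreeBelow n q
  DegreeBelow-resp e low = below λ n≤k → ≡.trans (≡.sym (at e _)) (vanishes low n≤k)

  HasDegree-resp : ∀ {d p q} → p ≈ q → HasDegree p d → HasDegree q d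
  HasDegree-resp {d} e (hasDegree lead low) = hasDegree (≡.trans (≡.sym (at e d)) lead) (DegreeBelow-resp e low)

  DegreeBelow-weaken : ∀ {m n p} → m ≤ n → DegreeBelow m p → DegreeBelow n p
  DegreeBelow-weaken m≤n low = below λ n≤k → vanishes low (ℕ.≤-trans m≤n n≤k)

  DegreeBelow-tighten : ∀ {n p} → DegreeBelow (suc n) p → coeff p n ≡ false → DegreeBelow n p
  DegreeBelow-tighten low eq = below λ n≤k → [ vanishes low , (λ { ≡.refl → eq }) ]′ (ℕ.m≤n⇒m<n∨m≡n n≤k)

  DegreeBelow-+ : ∀ {n p q} → DegreeBelow n p → DegreeBelow n q → DegreeBelow n (p + q)
  DegreeBelow-+ {n} {p} {q} lowp lowq = below λ {k} n≤k →
    ≡.trans (coeff-+ p q k) (≡.cong₂ _xor_ (vanishes lowp n≤k) (vanishes lowq n≤k))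

  DegreeBelow-∷ : ∀ {n p} a → DegreeBelow n p → DegreeBelow (suc n) (a ∷ p)
  DegreeBelow-∷ a low = below λ { (s≤s n≤k) → vanishes low n≤k }

  DegreeBelow-tail : ∀ {n p a} → DegreeBelow (suc n) (a ∷ p) → DegreeBelow n p
  DegreeBelow-tail low = below λ n≤k → vanishes low (s≤s n≤k)

  DegreeBelow-· : ∀ {n} b {p} → DegreeBelow n p → DegreeBelow n (b · p)
  DegreeBelow-· b {p} low = below λ {k} n≤k →
    ≡.trans (coeff-· b p k) (≡.trans (≡.cong (b ∧_) (vanishes low n≤k)) (∧-zeroʳ b))

  DegreeBelow-0⇒≈0 : ∀ {p} → DegreeBelow 0 p → p ≈ 0#
  DegreeBelow-0⇒≈0 low = pointwise λ k → vanishes low z≤n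

  HasDegree⇒≉0 : ∀ {p d} → HasDegree p d → ¬ p ≈ 0#
  HasDegree⇒≉0 {d = d} degp p≈0 with () ← ≡.trans (≡.sym (leading degp)) (at p≈0 d)

  HasDegree-below : ∀ {p d n} → HasDegree p d → DegreeBelow n p → d < n
  HasDegree-below degp low = ℕ.≰⇒> λ n≤d → contradiction (≡.trans (≡.sym (leading degp)) (vanishes low n≤d)) λ ()

  HasDegree-unique : ∀ {p d e} → HasDegree p d → HasDegree p e → d ≡ e
  HasDegree-unique degᵈ degᵉ = ℕ.≤-antisym
    (ℕ.s≤s⁻¹ (HasDegree-below degᵈ (upper degᵉ))) (ℕ.s≤s⁻¹ (HasDegree-below degᵉ (upper degᵈ)))

  HasDegree-∷ : ∀ {d p} a → HasDegree p d → HasDegree (a ∷ p) (suc d)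
  HasDegree-∷ a (hasDegree lead low) = hasDegree lead (DegreeBelow-∷ a low)

  HasDegree-+ : ∀ {d p q} → HasDegree p d → DegreeBelow d q → HasDegree (p + q) d
  HasDegree-+ {d} {p} {q} (hasDegree lead low) lowq = hasDegree
    (≡.trans (coeff-+ p q d) (≡.cong₂ _xor_ lead (vanishes lowq ℕ.≤-refl)))
    (DegreeBelow-+ low (DegreeBelow-weaken (ℕ.n≤1+n d) lowq))

  ≈0⊎HasDegree : ∀ p → p ≈ 0# ⊎ ∃ (HasDegree p)
  ≈0⊎HasDegree [] = inj₁ refl
  ≈0⊎HasDegree (a ∷ p) with ≈0⊎HasDegree p
  ≈0⊎HasDegree (a ∷ p)     | inj₂ (d , degp) = inj₂ (suc d , HasDegree-∷ a degp)
  ≈0⊎HasDegree (false ∷ p) | inj₁ p≈0 = inj₁ (trans (∷-cong ≡.refl p≈0) false∷[])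
  ≈0⊎HasDegree (true ∷ p)  | inj₁ p≈0 =
    inj₂ (0 , hasDegree ≡.refl (DegreeBelow-∷ true (below λ _ → at p≈0 _)))

  HasDegree-0⇒≈1 : ∀ {p} → HasDegree p 0 → p ≈ 1#
  HasDegree-0⇒≈1 {a ∷ p} (hasDegree ≡.refl low) = ∷-cong ≡.refl (DegreeBelow-0⇒≈0 (DegreeBelow-tail low))

  HasDegree-1 : HasDegree 1# 0
  HasDegree-1 = hasDegree ≡.refl (DegreeBelow-∷ true (below λ _ → ≡.refl))

  HasDegree-* : ∀ {d e p q} → HasDegree p d → HasDegree q e → HasDegree (p * q) (d ℕ.+ e)
  HasDegree-* {zero} {e} {p} {q} degp degq =
    HasDegree-resp (sym (trans (*-congʳ (HasDegree-0⇒≈1 degp)) (*-identityˡ q))) degq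
  HasDegree-* {suc d} {e} {a ∷ p} {q} (hasDegree lead low) degq =
    HasDegree-resp (trans (+-comm (false ∷ p * q) (a · q)) (sym (∷-* a p q)))
      (HasDegree-+
        (HasDegree-∷ false (HasDegree-* (hasDegree lead (DegreeBelow-tail low)) degq))
        (DegreeBelow-weaken (s≤s (ℕ.m≤n+m e d)) (DegreeBelow-· a (upper degq))))

  HasDegree-factors : ∀ {p q r e} → p * q ≈ r → HasDegree r e →
                      ∃₂ λ m n → HasDegree p m × HasDegree q n × m ℕ.+ n ≡ e
  HasDegree-factors {p} {q} pq≈r degr with ≈0⊎HasDegree p | ≈0⊎HasDegree q
  ... | inj₁ p≈0 | _        = contradiction (trans (sym pq≈r) (trans (*-congʳ p≈0) (zeroˡ q))) (HasDegree⇒≉0 degr)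
  ... | inj₂ _   | inj₁ q≈0 = contradiction (trans (sym pq≈r) (trans (*-congˡ q≈0) (zeroʳ p))) (HasDegree⇒≉0 degr)
  ... | inj₂ (m , degp) | inj₂ (n , degq) =
    m , n , degp , degq , HasDegree-unique (HasDegree-resp pq≈r (HasDegree-* degp degq)) degr

  -- Degrees add in products, so a nonzero multiple of `m` has degree at least `d`. Uniqueness of
  -- remainders rests on this.
  ∣-DegreeBelow⇒≈0 : ∀ {m r d} → HasDegree m d → DegreeBelow d r → m ∣ r → r ≈ 0#
  ∣-DegreeBelow⇒≈0 {m} {r} {d} degm low (k , km≈r) with ≈0⊎HasDegree r
  ... | inj₁ r≈0 = r≈0
  ... | inj₂ (e , degr) with HasDegree-factors km≈r degr
  ...   | i , j , degk , degm′ , i+j≡e with HasDegree-unique degm degm′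
  ...     | ≡.refl = contradiction (HasDegree-below degr low) (ℕ.≤⇒≯ (≡.subst (d ≤_) i+j≡e (ℕ.m≤n+m d i)))

  -- Long division, one coefficient at a time: the remainder of `p` is multiplied by `X`, `a` is
  -- added, and `m` is subtracted if the result has reached degree `d`.
  divMod : ∀ {m d} → HasDegree m d → ∀ p → ∃[ r ] (DegreeBelow d r × m ∣ p + r)
  divMod {m} degm [] = [] , below (λ _ → ≡.refl) , ∣-respʳ (sym (x+x≈0 [])) (m ∣0)
  divMod {m} {d} degm@(hasDegree lead low) (a ∷ p) with divMod degm p
  ... | r , lowr , m∣p+r = reduce (coeff (a ∷ r) d) ≡.refl
    where
    m∣a∷p+a∷r : m ∣ (a ∷ p) + (a ∷ r)
    m∣a∷p+a∷r = ∣-respʳ (trans (X* (p + r)) (trans (∷-cong (≡.sym (xor-same a)) refl) (sym (∷-+ a a p r))))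
                  (x∣ʳy⇒x∣ʳzy X m∣p+r)
    reduce : ∀ b → coeff (a ∷ r) d ≡ b → ∃[ r ] (DegreeBelow d r × m ∣ (a ∷ p) + r)
    reduce false eq = a ∷ r , DegreeBelow-tighten (DegreeBelow-∷ a lowr) eq , m∣a∷p+a∷r
    reduce true  eq = (a ∷ r) + m
      , DegreeBelow-tighten (DegreeBelow-+ (DegreeBelow-∷ a lowr) low)
          (≡.trans (coeff-+ (a ∷ r) m d) (≡.cong₂ _xor_ eq lead))
      , ∣-respʳ (+-assoc (a ∷ p) (a ∷ r) m) (∣-+ m∣a∷p+a∷r ∣-refl)

  _∣?_ : ∀ p q → Dec (p ∣ q)
  p ∣? q with ≈0⊎HasDegree p
  ... | inj₁ p≈0 with ≈0⊎HasDegree q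
  ...   | inj₁ q≈0 = yes (∣-respʳ (sym q≈0) (p ∣0))
  ...   | inj₂ (d , degq) = no λ (k , kp≈q) →
            HasDegree⇒≉0 degq (trans (sym kp≈q) (trans (*-congˡ {k} p≈0) (zeroʳ k)))
  p ∣? q | inj₂ (d , degp) with divMod degp q
  ... | r , lowr , p∣q+r with ≈0⊎HasDegree r
  ...   | inj₁ r≈0 = yes (∣-respʳ (trans (+-congˡ {q} r≈0) (+-identityʳ q)) p∣q+r)
  ...   | inj₂ (e , degr) = no λ p∣q → HasDegree⇒≉0 degr (∣-DegreeBelow⇒≈0 degp lowr
            (∣-+-cancelʳ {x = r} {y = q} (∣-respʳ (+-comm q r) p∣q+r) p∣q))

  -- Greatest common divisors and primes

  record Bézout (p q : Polynomial) : Set where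
    field
      gcd      : Polynomial
      gcd∣p    : gcd ∣ p
      gcd∣q    : gcd ∣ q
      u v      : Polynomial
      identity : u * p + v * q ≈ gcd

  -- Euclid's algorithm, recursive in a bound on the degree of the second argument.
  bézout : ∀ p q → Bézout p q
  bézout p q = euclid (suc (List.length q)) p q (lengthBound q)
    where
    lengthBound : ∀ q → DegreeBelow (suc (List.length q)) q
    lengthBound []      = below λ _ → ≡.refl
    lengthBound (a ∷ q) = DegreeBelow-∷ a (lengthBound q)
    base : ∀ p {q} → q ≈ 0# → Bézout p q
    base p {q} q≈0 = record
      { gcd = p ; gcd∣p = ∣-refl ; gcd∣q = ∣-respʳ (sym q≈0) (p ∣0)
      ; u = 1# ; v = 0# ; identity = trans (+-cong (*-identityˡ p) (zeroˡ q)) (+-identityʳ p) }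
    euclid : ∀ n p q → DegreeBelow n q → Bézout p q
    euclid zero    p q low = base p (DegreeBelow-0⇒≈0 low)
    euclid (suc n) p q low with ≈0⊎HasDegree q
    ... | inj₁ q≈0 = base p q≈0
    ... | inj₂ (d , degq) with divMod degq p
    ...   | r , lowr , q∣p+r@(k , kq≈p+r) = record
      { gcd = gcd
      ; gcd∣p = ∣-+-cancelʳ {x = p} {y = r} (∣-trans gcd∣p q∣p+r) gcd∣q
      ; gcd∣q = gcd∣p
      ; u = v
      ; v = u + v * k
      ; identity = begin
          v * p + (u + v * k) * q     ≈⟨ solve 5 (λ v p u k q → v :* p :+ (u :+ v :* k) :* q := u :* q :+ v :* (p :+ k :* q)) refl v p u k q ⟩
          u * q + v * (p + k * q)     ≈⟨ +-congˡ {u * q} (*-congˡ {v} (+-congˡ {p} kq≈p+r)) ⟩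
          u * q + v * (p + (p + r))   ≈⟨ solve 5 (λ u q v p r → u :* q :+ v :* (p :+ (p :+ r)) := u :* q :+ v :* r) refl u q v p r ⟩
          u * q + v * r               ≈⟨ identity ⟩
          gcd                         ∎
      }
      where
      open Solver using (solve; _:+_; _:*_; _:=_)
      open SetoidReasoning setoid
      open Bézout (euclid n q r (DegreeBelow-weaken {p = r} (ℕ.s≤s⁻¹ (HasDegree-below {q} degq low)) lowr))

  -- In p = k · gcd(p, x) one factor is a unit. If it is k, then p is associated to the gcd and
  -- divides x; if it is the gcd, multiplying Bézout's identity by y exhibits y as a combination of
  -- p and xy.
  irreducible⇒prime : ∀ {p x y} → Irreducible rawSemiring p → p ∣ x * y → p ∣ x ⊎ p ∣ y
  irreducible⇒prime {p} {x} {y} (mkIrred _ split-∣1) p∣xy = divides gcd∣p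
    where
    open Bézout (bézout p x)
    divides : gcd ∣ p → p ∣ x ⊎ p ∣ y
    divides (k , kg≈p) with split-∣1 (sym kg≈p)
    ... | inj₁ (c , ck≈1) = inj₁ (∣-trans (c , p≈g) gcd∣q)
      where
      p≈g : c * p ≈ gcd
      p≈g = trans (*-congˡ (sym kg≈p)) (trans (sym (*-assoc c k gcd)) (trans (*-congʳ ck≈1) (*-identityˡ gcd)))
    ... | inj₂ (c , cg≈1) = inj₂ (∣-respʳ combination≈y (∣-+ (x∣ʳy⇒x∣ʳzy (c * (u * y)) ∣-refl) (x∣ʳy⇒x∣ʳzy (c * v) p∣xy)))
      where
      open Solver using (solve; _:+_; _:*_; _:=_)
      combination≈y : (c * (u * y)) * p + (c * v) * (x * y) ≈ y
      combination≈y = trans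
        (solve 6 (λ c u y p v x → (c :* (u :* y)) :* p :+ (c :* v) :* (x :* y) := (c :* (u :* p :+ v :* x)) :* y) refl c u y p v x)
        (trans (*-congʳ (trans (*-congˡ identity) cg≈1)) (*-identityˡ y))

  -- Counting residue classes

  -- The `d` binary digits of the index are the coefficients, the most significant digit being the
  -- constant term.
  fromIndex : ∀ d → Fin (2 ℕ.^ d) → Polynomial
  fromIndex zero    _ = []
  fromIndex (suc d) i = Inverse.to Fin.2↔Bool (Fin.quotient (2 ℕ.^ d) i) ∷ fromIndex d (Fin.remainder {2} (2 ℕ.^ d) i)

  toIndex : ∀ d → Polynomial → Fin (2 ℕ.^ d)
  toIndex zero    p = zero
  toIndex (suc d) p = Fin.combine (Inverse.from Fin.2↔Bool (coeff p 0)) (toIndex d (drop 1 p))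

  coeff-drop : ∀ p k → coeff (drop 1 p) k ≡ coeff p (suc k)
  coeff-drop []      k = ≡.refl
  coeff-drop (a ∷ p) k = ≡.refl

  toIndex-cong : ∀ d {p q} → p ≈ q → toIndex d p ≡ toIndex d q
  toIndex-cong zero    e = ≡.refl
  toIndex-cong (suc d) {p} {q} e = ≡.cong₂ Fin.combine (≡.cong (Inverse.from Fin.2↔Bool) (at e 0))
    (toIndex-cong d (pointwise λ k → ≡.trans (coeff-drop p k) (≡.trans (at e (suc k)) (≡.sym (coeff-drop q k)))))

  DegreeBelow-fromIndex : ∀ d i → DegreeBelow d (fromIndex d i)
  DegreeBelow-fromIndex zero    i = below λ _ → ≡.refl
  DegreeBelow-fromIndex (suc d) i = DegreeBelow-∷ _ (DegreeBelow-fromIndex d _)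

  toIndex-fromIndex : ∀ d i → toIndex d (fromIndex d i) ≡ i
  toIndex-fromIndex zero    zero = ≡.refl
  toIndex-fromIndex (suc d) i = ≡.trans
    (≡.cong₂ Fin.combine (Inverse.strictlyInverseʳ Fin.2↔Bool (Fin.quotient (2 ℕ.^ d) i)) (toIndex-fromIndex d _))
    (Fin.combine-remQuot {2} (2 ℕ.^ d) i)

  fromIndex-toIndex : ∀ d {p} → DegreeBelow d p → fromIndex d (toIndex d p) ≈ p
  fromIndex-toIndex zero    low = sym (DegreeBelow-0⇒≈0 low)
  fromIndex-toIndex (suc d) {p} low = trans
    (∷-cong (≡.trans (≡.cong (bit ∘ proj₁) decode) (Inverse.strictlyInverseˡ Fin.2↔Bool (coeff p 0)))
      (trans (reflexive (≡.cong (fromIndex d ∘ proj₂) decode)) (fromIndex-toIndex d tail-low)))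
    head∷tail
    where
    bit : Fin 2 → Bool
    bit = Inverse.to Fin.2↔Bool
    decode : Fin.remQuot {2} (2 ℕ.^ d) (toIndex (suc d) p) ≡ (Inverse.from Fin.2↔Bool (coeff p 0) , toIndex d (drop 1 p))
    decode = Fin.remQuot-combine (Inverse.from Fin.2↔Bool (coeff p 0)) (toIndex d (drop 1 p))
    tail-low : DegreeBelow d (drop 1 p)
    tail-low = below λ {k} d≤k → ≡.trans (coeff-drop p k) (vanishes low (s≤s d≤k))
    head∷tail : coeff p 0 ∷ drop 1 p ≈ p
    head∷tail = pointwise λ where
      zero    → ≡.refl
      (suc k) → coeff-drop p k

  module _ {m d} (degm : HasDegree m d) where
    open Quotient 𝔽₂[X].algebra m
    private
      module K = 𝔽₂Algebra quotientAlgebra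

      remainder : Polynomial → Polynomial
      remainder p = proj₁ (divMod degm p)

      remainder-below : ∀ p → DegreeBelow d (remainder p)
      remainder-below p = proj₁ (proj₂ (divMod degm p))

      remainder≈ : ∀ p → remainder p ≈ₚ p
      remainder≈ p = K.sym {p} {remainder p} (mod (proj₂ (proj₂ (divMod degm p))))

      below-unique : ∀ {r r′} → DegreeBelow d r → DegreeBelow d r′ → r ≈ₚ r′ → r ≈ r′
      below-unique low low′ (mod m∣r+r′) = x+y≈0⇒x≈y (∣-DegreeBelow⇒≈0 degm (DegreeBelow-+ low low′) m∣r+r′)

      index : Polynomial → Fin (2 ℕ.^ d)
      index p = toIndex d (remainder p)

      index-cong : ∀ {p q} → p ≈ₚ q → index p ≡ index q
      index-cong {p} {q} p≈q = toIndex-cong d (below-unique (remainder-below p) (remainder-below q)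
        (K.trans (remainder≈ p) (K.trans p≈q (K.sym (remainder≈ q)))))

      fromIndex-index : ∀ p → fromIndex d (index p) ≈ₚ p
      fromIndex-index p = K.trans (≈⇒≈ₚ (fromIndex-toIndex d (remainder-below p))) (remainder≈ p)

      index-fromIndex : ∀ i → index (fromIndex d i) ≡ i
      index-fromIndex i = ≡.trans
        (toIndex-cong d (below-unique (remainder-below p) (DegreeBelow-fromIndex d i) (remainder≈ p)))
        (toIndex-fromIndex d i)
        where
        p : Polynomial
        p = fromIndex d i

    -- Each class contains exactly one polynomial of degree below `d`, and `fromIndex d` lists
    -- these.
    quotient-finite : Inverse (≡.setoid (Fin (2 ℕ.^ d))) (𝔽₂Algebra.setoid (Quotient.quotientAlgebra 𝔽₂[X].algebra m))
    quotient-finite = record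
      { to = fromIndex d
      ; from = index
      ; to-cong = λ { ≡.refl → K.refl }
      ; from-cong = λ {p} {q} → index-cong {p} {q}
      ; inverse = (λ { {p} ≡.refl → fromIndex-index p })
                , λ {i} {p} p≈i → ≡.trans (index-cong {p} {fromIndex d i} p≈i) (index-fromIndex i)
      }

  -- Irreducible factors

  Nonconstant : Polynomial → Set
  Nonconstant p = ∃[ d ] HasDegree p (suc d)

  nonconstant? : ∀ p → Dec (Nonconstant p)
  nonconstant? p with ≈0⊎HasDegree p
  ... | inj₁ p≈0            = no λ (_ , degp) → HasDegree⇒≉0 degp p≈0
  ... | inj₂ (suc d , degp) = yes (d , degp)
  ... | inj₂ (zero  , degp) = no λ (_ , degp′) → contradiction (HasDegree-unique degp degp′) λ ()

  nonconstant∤1 : ∀ {p} → Nonconstant p → p ∤ 1#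
  nonconstant∤1 (d , degp) (k , kp≈1) with HasDegree-factors kp≈1 HasDegree-1
  ... | i , j , _ , degp′ , i+j≡0 with HasDegree-unique degp degp′
  ...   | ≡.refl = contradiction (ℕ.m+n≡0⇒n≡0 i i+j≡0) λ ()

  -- A proper factor has smaller degree, so all candidates lie in the finite list
  -- `fromIndex (suc d)`. If one divides `p` the search continues in it with a smaller bound; if
  -- none does, `p` itself is irreducible.
  irreducibleFactor : ∀ p → Nonconstant p → ∃[ d ] ∃[ q ] (HasDegree q (suc d) × q ∣ p × Irreducible rawSemiring q)
  irreducibleFactor p (d , degp) = search d p degp ℕ.≤-refl
    where
    search : ∀ n {d} p → HasDegree p (suc d) → d ≤ n → ∃[ e ] ∃[ q ] (HasDegree q (suc e) × q ∣ p × Irreducible rawSemiring q)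
    search n {d} p degp d≤n with Fin.any? (λ i → nonconstant? (fromIndex (suc d) i) ×-dec (fromIndex (suc d) i ∣? p))
    search zero {zero} p degp z≤n | yes (i , (e , dege) , _) =
      contradiction (HasDegree-below dege (DegreeBelow-fromIndex 1 i)) λ { (s≤s ()) }
    search (suc n) {d} p degp d≤n | yes (i , (e , dege) , factor∣p)
      with search n (fromIndex (suc d) i) dege
             (ℕ.s≤s⁻¹ (ℕ.≤-trans (ℕ.s≤s⁻¹ (HasDegree-below dege (DegreeBelow-fromIndex (suc d) i))) d≤n))
    ... | e′ , q , degq , q∣factor , irred = e′ , q , degq , ∣-trans q∣factor factor∣p , irred
    search n {d} p degp d≤n | no ∄factor = d , p , degp , ∣-refl , mkIrred (nonconstant∤1 (d , degp)) split
      where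
      unit : ∀ {x} → HasDegree x 0 → x ∣ 1#
      unit degx = ∣-respʳ (HasDegree-0⇒≈1 degx) ∣-refl
      split : ∀ {x y} → p ≈ x * y → x ∣ 1# ⊎ y ∣ 1#
      split {x} {y} p≈xy with HasDegree-factors (sym p≈xy) degp
      ... | zero  , _ , degx , _ , _ = inj₁ (unit degx)
      ... | suc i , zero , _ , degy , _ = inj₂ (unit degy)
      -- If both factors are nonconstant, `x` has degree at most `d` and is one of the candidates
      -- just ruled out.
      ... | suc i , suc j , degx , degy , i+j≡d = contradiction
        (toIndex (suc d) x , (i , HasDegree-resp (sym x′≈x) degx)
          , ∣-respˡ (sym x′≈x) (∣-respʳ (sym p≈xy) (∣-*ʳ y ∣-refl)))
        ∄factor
        where
        x′≈x : fromIndex (suc d) (toIndex (suc d) x) ≈ x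
        x′≈x = fromIndex-toIndex (suc d) (DegreeBelow-weaken
          (≡.subst (suc (suc i) ≤_) (≡.trans (≡.sym (ℕ.+-suc (suc i) j)) i+j≡d) (ℕ.m≤m+n (suc (suc i)) j)) (upper degx))

  -- Residue fields and irreducible polynomials of every degree

  module _ {p} (irred : Irreducible rawSemiring p) where
    open Quotient 𝔽₂[X].algebra p using (quotientAlgebra; p∣x⇒x≈ₚ0; x≈ₚ0⇒p∣x)

    quotient-isDomain : IsDomain quotientAlgebra
    quotient-isDomain = record
      { 1≉0 = Irreducible.p∤1 irred ∘ x≈ₚ0⇒p∣x
      ; xy≈0⇒x≈0⊎y≈0 = Sum.map p∣x⇒x≈ₚ0 p∣x⇒x≈ₚ0 ∘ irreducible⇒prime irred ∘ x≈ₚ0⇒p∣x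
      }

  -- The polynomial with root set 𝔽_{2ⁿ} in an algebraic closure.
  fieldPolynomial : ℕ → Polynomial
  fieldPolynomial n = X ^ (2 ℕ.^ n) + X

  module _ {p} n (p∣f : p ∣ fieldPolynomial n) where
    open Quotient 𝔽₂[X].algebra p
    private
      module K where
        open 𝔽₂Algebra quotientAlgebra public
        open 𝔽₂AlgebraProperties quotientAlgebra public
      N : ℕ
      N = 2 ℕ.^ n

    -- Raising to the power `N` respects sums and products, and it fixes the constants and, by
    -- hypothesis, the class of `X`. These generate all polynomials, so induction on the coefficient
    -- list applies.
    ∣fieldPolynomial⇒fixed : ∀ y → K._≈_ (K._^_ y N) y
    ∣fieldPolynomial⇒fixed []      = K.0^2^n≈0 n
    ∣fieldPolynomial⇒fixed (b ∷ y) = begin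
      (b ∷ y) K.^ N                           ≈⟨ K.^-congˡ N (≈⇒≈ₚ (∷-decompose b y)) ⟩
      ((b ∷ []) + X * y) K.^ N                ≈⟨ K.frobenius n (b ∷ []) (X * y) ⟩
      (b ∷ []) K.^ N + (X * y) K.^ N          ≈⟨ K.+-cong (constant b) (K.^-distrib-* X y N) ⟩
      (b ∷ []) + (X K.^ N) * (y K.^ N)        ≈⟨ K.+-congˡ (K.*-cong X^N≈X (∣fieldPolynomial⇒fixed y)) ⟩
      (b ∷ []) + X * y                        ≈⟨ ≈⇒≈ₚ (∷-decompose b y) ⟨
      b ∷ y                                   ∎
      where
      open SetoidReasoning K.setoid
      X^N≈X : K._≈_ (K._^_ X N) X
      X^N≈X = ≡.subst (_≈ₚ X) (≡.sym (^-quotient X N)) (mod p∣f)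
      constant : ∀ b → K._≈_ (K._^_ (b ∷ []) N) (b ∷ [])
      constant true  = K.1^n≈1 N
      constant false = K.trans (K.^-congˡ N (≈⇒≈ₚ false∷[])) (K.trans (K.0^2^n≈0 n) (≈⇒≈ₚ (sym false∷[])))

  HasDegree-X : HasDegree X 1
  HasDegree-X = HasDegree-∷ false HasDegree-1

  HasDegree-X^ : ∀ n → HasDegree (X ^ n) n
  HasDegree-X^ zero    = HasDegree-1
  HasDegree-X^ (suc n) = HasDegree-* HasDegree-X (HasDegree-X^ n)

  2≤2^[1+n] : ∀ n → 2 ≤ 2 ℕ.^ suc n
  2≤2^[1+n] n = ℕ.*-monoʳ-≤ 2 (ℕ.>-nonZero⁻¹ (2 ℕ.^ n) {{ℕ.m^n≢0 2 n}})

  -- The successor excludes the exponent 1, for which the polynomial is X + X = 0.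
  HasDegree-fieldPolynomial : ∀ n → HasDegree (fieldPolynomial (suc n)) (2 ℕ.^ suc n)
  HasDegree-fieldPolynomial n = HasDegree-+ (HasDegree-X^ (2 ℕ.^ suc n))
    (DegreeBelow-weaken (2≤2^[1+n] n) (upper HasDegree-X))

  -- The preceding fixed-point property with the field polynomial itself as modulus.
  fieldPolynomial∣ : ∀ n y → fieldPolynomial n ∣ y ^ (2 ℕ.^ n) + y
  fieldPolynomial∣ n y = Quotient.p∣x+y
    (≡.subst (λ z → z ≈ₚ y) (^-quotient y (2 ℕ.^ n)) (∣fieldPolynomial⇒fixed n ∣-refl y))
    where open Quotient 𝔽₂[X].algebra (fieldPolynomial n)

  -- If p² divides X^(2ⁿ) + X then it divides p^(2ⁿ) + p, hence p itself.
  fieldPolynomial-squarefree : ∀ n {p} → Nonconstant p → p * p ∤ fieldPolynomial (suc n)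
  fieldPolynomial-squarefree n {p} (d , degp) pp∣f with ℕ.m≤n⇒∃[o]m+o≡n (2≤2^[1+n] n)
  ... | k , 2+k≡2^n = absurd pp∣p
    where
    pp∣p^2+k : p * p ∣ p ^ (2 ℕ.+ k)
    pp∣p^2+k = ∣-respʳ (*-assoc p p (p ^ k)) (∣-*ʳ (p ^ k) ∣-refl)
    pp∣p : p * p ∣ p
    pp∣p = ∣-+-cancelʳ (∣-respʳ (+-comm (p ^ (2 ℕ.+ k)) p)
      (≡.subst (λ N → p * p ∣ p ^ N + p) (≡.sym 2+k≡2^n) (∣-trans pp∣f (fieldPolynomial∣ (suc n) p)))) pp∣p^2+k
    absurd : ¬ p * p ∣ p
    absurd (c , cpp≈p) with HasDegree-factors cpp≈p degp
    ... | i , j , _ , degpp , i+j≡1+d with HasDegree-unique degpp (HasDegree-* degp degp)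
    ...   | ≡.refl = ℕ.<⇒≱ (ℕ.m<m+n (suc d) ℕ.z<s)
                       (ℕ.≤-trans (ℕ.m≤n+m _ i) (ℕ.≤-reflexive i+j≡1+d))

  fieldProduct : ℕ → Polynomial
  fieldProduct zero    = 1#
  fieldProduct (suc n) = fieldPolynomial (suc n) * fieldProduct n

  -- The geometric sum 2 + 4 + ... + 2^n = 2^(n+1) - 2: two short of the degree of
  -- `fieldPolynomial (suc n)`.
  HasDegree-fieldProduct : ∀ n → ∃[ e ] (HasDegree (fieldProduct n) e × 2 ℕ.+ e ≡ 2 ℕ.^ suc n)
  HasDegree-fieldProduct zero = 0 , HasDegree-1 , ≡.refl
  HasDegree-fieldProduct (suc n) with HasDegree-fieldProduct n
  ... | e , deg , 2+e≡N = 2 ℕ.^ suc n ℕ.+ e , HasDegree-* (HasDegree-fieldPolynomial n) deg , (begin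
    2 ℕ.+ (N ℕ.+ e)       ≡⟨ ℕ.+-suc 1 (N ℕ.+ e) ⟨
    1 ℕ.+ suc (N ℕ.+ e)   ≡⟨ ≡.cong suc (ℕ.+-suc N e) ⟨
    suc (N ℕ.+ suc e)     ≡⟨ ℕ.+-suc N (suc e) ⟨
    N ℕ.+ (2 ℕ.+ e)       ≡⟨ ≡.cong (N ℕ.+_) (≡.trans 2+e≡N (≡.sym (ℕ.+-identityʳ N))) ⟩
    2 ℕ.* N               ∎)
    where
    open ≡.≡-Reasoning
    N : ℕ
    N = 2 ℕ.^ suc n

  fieldPolynomial∣fieldProduct : ∀ {i n} → i < n → fieldPolynomial (suc i) ∣ fieldProduct n
  fieldPolynomial∣fieldProduct {i} {suc n} (s≤s i≤n) with ℕ.m≤n⇒m<n∨m≡n i≤n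
  ... | inj₁ i<n    = x∣ʳy⇒x∣ʳzy (fieldPolynomial (suc n)) (fieldPolynomial∣fieldProduct i<n)
  ... | inj₂ ≡.refl = ∣-*ʳ (fieldProduct n) ∣-refl

  -- An irreducible factor of degree d ≤ n divides X^(2^d) + X, hence fieldProduct n, whose degree
  -- is too small for it to absorb all factors of the squarefree polynomial fieldPolynomial (suc n).
  largeIrreducibleFactor : ∀ n → ∃[ d ] ∃[ p ] (HasDegree p (suc d) × Irreducible rawSemiring p ×
                                                p ∣ fieldPolynomial (suc n) × p ∤ fieldProduct n)
  largeIrreducibleFactor n = factor gcd∣p gcd∣q
    where
    open Bézout (bézout (fieldPolynomial (suc n)) (fieldProduct n))
    factor : gcd ∣ fieldPolynomial (suc n) → gcd ∣ fieldProduct n → _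
    factor (h , hg≈f) (k , kg≈Q) = d , p , degp , irred , p∣f , p∤Q
      where
      -- The gcd divides `fieldProduct n`, whose degree is too small, so its cofactor `h` in the
      -- field polynomial cannot be constant.
      nonconstant-h : Nonconstant h
      nonconstant-h with HasDegree-fieldProduct n
      ... | e , degQ , 2+e≡N
        with HasDegree-factors hg≈f (HasDegree-fieldPolynomial n) | HasDegree-factors kg≈Q degQ
      ... | suc m , _ , degh , _ | _ = m , degh
      ... | zero , i , _ , degg , i≡N | j , i′ , _ , degg′ , j+i′≡e with HasDegree-unique degg degg′
      ...   | ≡.refl = contradiction
        (ℕ.≤-trans (ℕ.≤-reflexive (≡.trans 2+e≡N (≡.sym i≡N))) (ℕ.≤-trans (ℕ.m≤n+m i j) (ℕ.≤-reflexive j+i′≡e)))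
        (ℕ.<⇒≱ (ℕ.m≤n+m (suc e) 1))
      factors = irreducibleFactor h nonconstant-h
      d = proj₁ factors
      p = proj₁ (proj₂ factors)
      degp : HasDegree p (suc d)
      degp = proj₁ (proj₂ (proj₂ factors))
      p∣h : p ∣ h
      p∣h = proj₁ (proj₂ (proj₂ (proj₂ factors)))
      irred : Irreducible rawSemiring p
      irred = proj₂ (proj₂ (proj₂ (proj₂ factors)))
      p∣f : p ∣ fieldPolynomial (suc n)
      p∣f = ∣-respʳ hg≈f (∣-*ʳ gcd p∣h)
      -- Dividing both polynomials, `p` would divide their gcd as well as the cofactor `h`, so its
      -- square would divide the squarefree field polynomial.
      p∤Q : p ∤ fieldProduct n
      p∤Q p∣Q = fieldPolynomial-squarefree n (d , degp) (∣-respʳ hg≈f (square p∣h p∣gcd))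
        where
        p∣gcd : p ∣ gcd
        p∣gcd = ∣-respʳ identity (∣-+ (x∣ʳy⇒x∣ʳzy u p∣f) (x∣ʳy⇒x∣ʳzy v p∣Q))
        square : ∀ {x y} → p ∣ x → p ∣ y → p * p ∣ x * y
        square (a , ap≈x) (b , bp≈y) = a * b , trans
          (solve 3 (λ a b p → (a :* b) :* (p :* p) := (a :* p) :* (b :* p)) refl a b p) (*-cong ap≈x bp≈y)
          where open Solver using (solve; _:*_; _:=_)

  module _ {p d} (degp : HasDegree p (suc d)) (irred : Irreducible rawSemiring p) where
    open Quotient 𝔽₂[X].algebra p
    private
      domain : IsDomain quotientAlgebra
      domain = quotient-isDomain irred
      finite : Inverse (≡.setoid (Fin (2 ℕ.^ suc d))) (𝔽₂Algebra.setoid quotientAlgebra)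
      finite = quotient-finite degp
    open FiniteDomainProperties quotientAlgebra domain finite using (fermat; element-injective)
    open DomainProperties quotientAlgebra domain using (#fixedPoints≤exponent)

    -- This is Fermat's little theorem for the class of `X`.
    irreducible∣fieldPolynomial : p ∣ fieldPolynomial (suc d)
    irreducible∣fieldPolynomial = p∣x+y (≡.subst (_≈ₚ X) (^-quotient X (2 ℕ.^ suc d)) (fermat X))

    -- Every one of the 2^(d+1) residue classes is fixed by the power 2^(n+1), and a domain has at
    -- most that many fixed points.
    ∣fieldPolynomial⇒degree≤ : ∀ n → p ∣ fieldPolynomial (suc n) → suc d ≤ suc n
    ∣fieldPolynomial⇒degree≤ n p∣f = ℕ.≮⇒≥ λ n<d → ℕ.<⇒≱ (ℕ.^-monoʳ-< 2 (s≤s (s≤s z≤n)) n<d) 2^d≤2^n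
      where
      2^d≤2^n : 2 ℕ.^ suc d ≤ 2 ℕ.^ suc n
      2^d≤2^n with ℕ.m≤n⇒∃[o]m+o≡n (2≤2^[1+n] n)
      ... | k , 2+k≡N = ≡.subst (2 ℕ.^ suc d ≤_) 2+k≡N
        (#fixedPoints≤exponent k (Inverse.to finite) element-injective λ i →
          ≡.subst (λ N → 𝔽₂AlgebraProperties._^_ quotientAlgebra (Inverse.to finite i) N ≈ₚ Inverse.to finite i)
            (≡.sym 2+k≡N) (∣fieldPolynomial⇒fixed (suc n) p∣f (Inverse.to finite i)))

  degree≡ : ∀ {n d p} → HasDegree p (suc d) → Irreducible rawSemiring p →
                             p ∣ fieldPolynomial (suc n) → p ∤ fieldProduct n → suc d ≡ suc n
  degree≡ {n} {d} degp irred p∣f p∤Q = ℕ.≤-antisym (∣fieldPolynomial⇒degree≤ degp irred n p∣f) n≤d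
    where
    n≤d : suc n ≤ suc d
    n≤d = s≤s (ℕ.≮⇒≥ λ d<n → p∤Q (∣-trans (irreducible∣fieldPolynomial degp irred) (fieldPolynomial∣fieldProduct d<n)))

  irreducibleOfDegree : ∀ n → ∃[ p ] (HasDegree p (suc n) × Irreducible rawSemiring p)
  irreducibleOfDegree n =
    let d , p , degp , irred , p∣f , p∤Q = largeIrreducibleFactor n in
    p , ≡.subst (HasDegree p) (degree≡ degp irred p∣f p∤Q) degp , irred

  finiteDomain : ∀ n → Σ 𝔽₂Algebra λ K → IsDomain K × Inverse (≡.setoid (Fin (2 ℕ.^ suc n))) (𝔽₂Algebra.setoid K)
  finiteDomain n =
    let p , degp , irred = irreducibleOfDegree n in
    Quotient.quotientAlgebra 𝔽₂[X].algebra p , quotient-isDomain irred , quotient-finite degp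

-- Enumerations and girth

to-injective : ∀ {A B : Set} (f : A ↔ B) → Injective _≡_ _≡_ (Inverse.to f)
to-injective f = Injection.injective (↔⇒↣ f)

-- Evidence that exactly `k` elements satisfy `P`, in a form that lets counts be compared along
-- injections.
record Enumeration {A : Set} (P : Pred A 0ℓ) (k : ℕ) : Set where
  field
    member    : Fin k → A
    injective : Injective _≡_ _≡_ member
    sound     : ∀ i → P (member i)
    complete  : ∀ {x} → P x → ∃[ i ] member i ≡ x
open Enumeration

enumeration-≤ : ∀ {A B : Set} {P : Pred A 0ℓ} {Q : Pred B 0ℓ} {k l} → Enumeration P k → Enumeration Q l →
                (f : A → B) → (∀ {x} → P x → Q (f x)) → (∀ {x y} → P x → P y → f x ≡ f y → x ≡ y) → k ≤ l
enumeration-≤ E F f f-sound f-injective = Fin.injective⇒≤ {f = λ i → proj₁ (hit i)} λ {i} {j} eq →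
  injective E (f-injective (sound E i) (sound E j)
    (≡.trans (≡.sym (proj₂ (hit i))) (≡.trans (≡.cong (member F) eq) (proj₂ (hit j)))))
  where
  hit : ∀ i → ∃[ j ] member F j ≡ f (member E i)
  hit i = complete F (f-sound (sound E i))

enumeration-unique : ∀ {A : Set} {P : Pred A 0ℓ} {k l} → Enumeration P k → Enumeration P l → k ≡ l
enumeration-unique E F =
  ℕ.≤-antisym (enumeration-≤ E F id id (λ _ _ → id)) (enumeration-≤ F E id id (λ _ _ → id))

enumeration-⊎ : ∀ {A B : Set} {P : Pred (A ⊎ B) 0ℓ} {k l} → Enumeration (P ∘ inj₁) k → Enumeration (P ∘ inj₂) l →
                Enumeration P (k ℕ.+ l)
enumeration-⊎ {A} {B} {P} {k} {l} E F = record
  { member    = element ∘ split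
  ; injective = λ eq → to-injective Fin.+↔⊎ (element-injective _ _ eq)
  ; sound     = element-sound ∘ split
  ; complete  = λ {x} px →
      let s , eq = element-complete x px in
      Inverse.from Fin.+↔⊎ s , ≡.trans (≡.cong element (Inverse.strictlyInverseˡ (Fin.+↔⊎ {k} {l}) s)) eq
  }
  where
  split : Fin (k ℕ.+ l) → Fin k ⊎ Fin l
  split = Inverse.to Fin.+↔⊎
  element : Fin k ⊎ Fin l → A ⊎ B
  element = Sum.map (member E) (member F)
  element-injective : ∀ s t → element s ≡ element t → s ≡ t
  element-injective (inj₁ _) (inj₁ _) eq = ≡.cong inj₁ (injective E (Sum.inj₁-injective eq))
  element-injective (inj₂ _) (inj₂ _) eq = ≡.cong inj₂ (injective F (Sum.inj₂-injective eq))
  element-sound : ∀ s → P (element s)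
  element-sound (inj₁ i) = sound E i
  element-sound (inj₂ j) = sound F j
  element-complete : ∀ x → P x → ∃[ s ] element s ≡ x
  element-complete (inj₁ a) pa = let i , eq = complete E pa in inj₁ i , ≡.cong inj₁ eq
  element-complete (inj₂ b) pb = let j , eq = complete F pb in inj₂ j , ≡.cong inj₂ eq

enumeration-preimage : ∀ {A B : Set} {P : Pred B 0ℓ} {k} (f : A ↔ B) → Enumeration P k → Enumeration (P ∘ Inverse.to f) k
enumeration-preimage {P = P} f E = record
  { member    = from ∘ member E
  ; injective = injective E ∘ to-injective (↔-sym f)
  ; sound     = λ i → ≡.subst P (≡.sym (strictlyInverseˡ _)) (sound E i)
  ; complete  = λ px → let i , eq = complete E px in i , ≡.trans (≡.cong from eq) (strictlyInverseʳ _)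
  }
  where open Inverse f

lookup-injective : ∀ {A : Set} {xs : List A} → Unique xs → Injective _≡_ _≡_ (List.lookup xs)
lookup-injective (x∉xs ∷ u) {zero}  {zero}  eq = ≡.refl
lookup-injective (x∉xs ∷ u) {zero}  {suc j} eq = contradiction eq (All.lookup x∉xs (Membership.∈-lookup j))
lookup-injective (x∉xs ∷ u) {suc i} {zero}  eq = contradiction (≡.sym eq) (All.lookup x∉xs (Membership.∈-lookup i))
lookup-injective (x∉xs ∷ u) {suc i} {suc j} eq = ≡.cong suc (lookup-injective u eq)

filter-enumeration : ∀ {n} {P : Pred (Fin n) 0ℓ} (P? : Decidable P) → Enumeration P (length (filter P? (allFin n)))
filter-enumeration {n} P? = record
  { member    = List.lookup (filter P? (allFin n))
  ; injective = lookup-injective (Unique.filter⁺ P? (Unique.allFin⁺ n))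
  ; sound     = λ i → All.lookup (All.all-filter P? (allFin n)) (Membership.∈-lookup i)
  ; complete  = λ {x} px → let x∈ = Membership.∈-filter⁺ P? (Membership.∈-allFin x) px in
                  Any.index x∈ , ≡.sym (lookup-index x∈)
  }

-- Short cycles and the lower bound on the order

module GraphProperties (G : Graph) where
  open Graph G

  neighbours : ∀ v → Enumeration (v ~_) (degree v)
  neighbours v = filter-enumeration (v ~?_)

  degree≡ : ∀ {v k} → Enumeration (v ~_) k → degree v ≡ k
  degree≡ = enumeration-unique (neighbours _)

  ~⇒≢ : ∀ {u v} → u ~ v → u ≢ v
  ~⇒≢ u~v u≡v = irrefl u≡v u~v

  TriangleFree : Set
  TriangleFree = ∀ {u v w} → u ~ v → v ~ w → w ~ u → ⊥

  SquareFree : Set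
  SquareFree = ∀ {u v w x} → u ~ v → v ~ w → w ~ x → x ~ u → u ≢ w → v ≢ x → ⊥

  5≤cycle : TriangleFree → SquareFree → ∀ ℓ → HasCycle G ℓ → 5 ≤ ℓ
  5≤cycle no△ no□ _ (0 , ≡.refl , c) with () ← ℕ.s≤s⁻¹ (CycleOn.3≤length c)
  5≤cycle no△ no□ _ (1 , ≡.refl , c) with s≤s (s≤s ()) ← CycleOn.3≤length c
  5≤cycle no△ no□ _ (2 , ≡.refl , c) = contradiction (CycleOn.close c) (no△ (CycleOn.step c zero) (CycleOn.step c (suc zero)))
  5≤cycle no△ no□ _ (3 , ≡.refl , c) = ⊥-elim (no□
    (CycleOn.step c zero) (CycleOn.step c (suc zero)) (CycleOn.step c (suc (suc zero))) (CycleOn.close c)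
    (λ eq → contradiction (CycleOn.distinct c eq) λ ()) (λ eq → contradiction (CycleOn.distinct c eq) λ ()))
  5≤cycle no△ no□ _ (suc (suc (suc (suc k))) , ≡.refl , c) = s≤s (s≤s (s≤s (s≤s (s≤s z≤n))))

  girth5⇒triangleFree : HasGirth G 5 → TriangleFree
  girth5⇒triangleFree (_ , least) {u} {v} {w} uv vw wu = ℕ.<⇒≱ {3} {5} (ℕ.m≤n+m 4 1) (least 3 (2 , ≡.refl , record
    { 3≤length = ℕ.≤-refl
    ; vertex = List.lookup (u ∷ v ∷ w ∷ [])
    ; distinct = lookup-injective ((~⇒≢ uv ∷ ~⇒≢ wu ∘ ≡.sym ∷ []) ∷ (~⇒≢ vw ∷ []) ∷ [] ∷ [])
    ; step = λ where
        zero       → uv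
        (suc zero) → vw
    ; close = wu }))

  girth5⇒squareFree : HasGirth G 5 → SquareFree
  girth5⇒squareFree (_ , least) {u} {v} {w} {x} uv vw wx xu u≢w v≢x = ℕ.<⇒≱ {4} {5} ℕ.≤-refl (least 4 (3 , ≡.refl , record
    { 3≤length = ℕ.n≤1+n 3
    ; vertex = List.lookup (u ∷ v ∷ w ∷ x ∷ [])
    ; distinct = lookup-injective
        ((~⇒≢ uv ∷ u≢w ∷ ~⇒≢ xu ∘ ≡.sym ∷ []) ∷ (~⇒≢ vw ∷ v≢x ∷ []) ∷ (~⇒≢ wx ∷ []) ∷ [] ∷ [])
    ; step = λ where
        zero             → uv
        (suc zero)       → vw
        (suc (suc zero)) → wx
    ; close = xu }))

  -- The vertices at distance 1 and 2 from v: for every neighbour w of v, the r chosen neighbours of w,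
  -- except that v itself is replaced by w.
  girth5⇒order> : ∀ {r} → HasGirth G 5 → (∀ u → r ≤ degree u) → ∀ v → degree v ℕ.* r < order
  girth5⇒order> {r} girth5 r≤degree v = Fin.injective⇒≤ {f = ball} ball-injective
    where
    no△ : TriangleFree
    no△ = girth5⇒triangleFree girth5
    no□ : SquareFree
    no□ = girth5⇒squareFree girth5
    w : Fin (degree v) → Vertex
    w = member (neighbours v)
    v~w : ∀ i → v ~ w i
    v~w = sound (neighbours v)
    x : Fin (degree v) → Fin r → Vertex
    x i j = member (neighbours (w i)) (inject≤ j (r≤degree (w i)))
    w~x : ∀ i j → w i ~ x i j
    w~x i j = sound (neighbours (w i)) _
    x-injective : ∀ i {j j′} → x i j ≡ x i j′ → j ≡ j′
    x-injective i = Fin.inject≤-injective _ _ _ _ ∘ injective (neighbours (w i))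

    -- Each `w i` contributes `r` vertices in either case: if `v` is not among its chosen
    -- neighbours, `w i` is left out and all `r` lie at distance 2 from `v`.
    data Representative (i : Fin (degree v)) (j : Fin r) : Vertex → Set where
      near : x i j ≡ v → Representative i j (w i)
      far  : x i j ≢ v → Representative i j (x i j)

    representative : ∀ i j → ∃ (Representative i j)
    representative i j with x i j Fin.≟ v
    ... | yes eq = w i , near eq
    ... | no neq = x i j , far neq

    -- Otherwise `v`, `w i′` and `w i` would form a triangle.
    w≢x : ∀ i i′ j′ → x i′ j′ ≢ v → w i ≢ x i′ j′
    w≢x i i′ j′ x≢v eq = no△ (v~w i′) (≡.subst (w i′ ~_) (≡.sym eq) (w~x i′ j′)) (sym (v~w i))

    unique : ∀ {i j i′ j′ a b} → Representative i j a → Representative i′ j′ b → a ≡ b → (i , j) ≡ (i′ , j′)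
    unique {i} {j} {i′} {j′} (near xv) (near xv′) eq with injective (neighbours v) {i} {i′} eq
    ... | ≡.refl = ≡.cong (i ,_) (x-injective i (≡.trans xv (≡.sym xv′)))
    unique {i} {j} {i′} {j′} (near _) (far x≢v) eq = contradiction eq (w≢x i i′ j′ x≢v)
    unique {i} {j} {i′} {j′} (far x≢v) (near _) eq = contradiction (≡.sym eq) (w≢x i′ i j x≢v)
    unique {i} {j} {i′} {j′} (far x≢v) (far _) eq with i Fin.≟ i′
    ... | yes ≡.refl = ≡.cong (i ,_) (x-injective i eq)
    -- A vertex other than `v` adjacent to both `w i` and `w i′` closes a square through `v`.
    ... | no i≢i′ = ⊥-elim (no□ (v~w i) (w~x i j) (≡.subst (_~ w i′) (≡.sym eq) (sym (w~x i′ j′))) (sym (v~w i′))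
                      (x≢v ∘ ≡.sym) (i≢i′ ∘ injective (neighbours v)))

    representative≢v : ∀ {i j a} → Representative i j a → v ≢ a
    representative≢v {i} (near _) = ~⇒≢ (v~w i)
    representative≢v (far x≢v)    = x≢v ∘ ≡.sym

    split : Fin (degree v ℕ.* r) → Fin (degree v) × Fin r
    split = Fin.remQuot r

    ball : Fin (suc (degree v ℕ.* r)) → Vertex
    ball zero    = v
    ball (suc k) = proj₁ (representative (proj₁ (split k)) (proj₂ (split k)))

    ball-injective : Injective _≡_ _≡_ ball
    ball-injective {zero}  {zero}  eq = ≡.refl
    ball-injective {zero}  {suc l} eq = contradiction eq (representative≢v (proj₂ (representative _ _)))
    ball-injective {suc k} {zero}  eq = contradiction (≡.sym eq) (representative≢v (proj₂ (representative _ _)))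
    ball-injective {suc k} {suc l} eq = ≡.cong suc (to-injective (Fin.*↔× {degree v} {r})
      (unique (proj₂ (representative _ _)) (proj₂ (representative _ _)) eq))

biregular⇒order> : ∀ {r m} (G : Graph) → r ≤ m → IsBiregular r m 5 G → m ℕ.* r < Graph.order G
biregular⇒order> {r} {m} G r≤m (girth5 , degrees) with Equivalence.from (degrees m) (inj₂ ≡.refl)
... | v , ≡.refl = girth5⇒order> girth5 r≤degree v
  where
  open Graph G using (degree)
  open GraphProperties G
  r≤degree : ∀ u → r ≤ degree u
  r≤degree u = [ (λ eq → ℕ.≤-reflexive (≡.sym eq)) , (λ eq → ℕ.≤-trans r≤m (ℕ.≤-reflexive (≡.sym eq))) ]′
    (Equivalence.to (degrees (degree u)) (u , ≡.refl))

degree-isomorphism : ∀ {G H} (φ : Isomorphism G H) v → Graph.degree H (Isomorphism.to φ v) ≡ Graph.degree G v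
degree-isomorphism {G} {H} φ v = ℕ.≤-antisym
  (enumeration-≤ (neighbours H (to v)) (neighbours G v) from
    (λ {x} φv~x → Equivalence.from (adjacency v (from x)) (≡.subst (Graph._~_ H (to v)) (≡.sym (strictlyInverseˡ x)) φv~x))
    (λ _ _ → to-injective (↔-sym bijection)))
  (enumeration-≤ (neighbours G v) (neighbours H (to v)) to
    (λ {x} → Equivalence.to (adjacency v x)) (λ _ _ → to-injective bijection))
  where
  open Isomorphism φ using (bijection; adjacency)
  open Inverse bijection using (to; from; strictlyInverseˡ)
  open GraphProperties using (neighbours)

-- This is the invariant that tells the cages apart.
#verticesOfDegree-isomorphism : ∀ {G H k l} d → Isomorphism G H →
  Enumeration (λ v → Graph.degree G v ≡ d) k → Enumeration (λ v → Graph.degree H v ≡ d) l → k ≡ l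
#verticesOfDegree-isomorphism {G} {H} d φ E F = ℕ.≤-antisym
  (enumeration-≤ E F to (λ {v} → ≡.trans (degree-isomorphism φ v)) (λ _ _ → to-injective bijection))
  (enumeration-≤ F E from
    (λ {v} deg≡d → ≡.trans (≡.sym (degree-isomorphism φ (from v)))
      (≡.trans (≡.cong (Graph.degree H) (strictlyInverseˡ v)) deg≡d))
    (λ _ _ → to-injective (↔-sym bijection)))
  where
  open Isomorphism φ using (bijection)
  open Inverse bijection using (to; from; strictlyInverseˡ)

-- Affine planes and their graphs

-- The lines of an affine plane of order q, sorted into q + 1 parallel classes of q lines each:
-- lineIndex c P is the position within class c of the line through P.
record AffinePlane (q : ℕ) : Set where
  field
    lineIndex : Fin (suc q) → Fin q × Fin q → Fin q
    unique    : ∀ {c d P Q} → c ≢ d → lineIndex c P ≡ lineIndex c Q → lineIndex d P ≡ lineIndex d Q → P ≡ Q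

  -- By `unique`, sending a point to its two line indices is injective on the q² points, and there
  -- are q² pairs of indices, so it is onto.
  meet : ∀ {c d} → c ≢ d → ∀ a b → ∃[ P ] (lineIndex c P ≡ a × lineIndex d P ≡ b)
  meet {c} {d} c≢d a b =
    let i , eq = injective⇒surjective encoded-injective (Inverse.from Fin.*↔× (a , b))
        eq′ = to-injective (↔-sym Fin.*↔×) eq
    in Inverse.to Fin.*↔× i , Product.,-injectiveˡ eq′ , Product.,-injectiveʳ eq′
    where
    indices : Fin q × Fin q → Fin q × Fin q
    indices P = lineIndex c P , lineIndex d P
    encoded-injective : Injective _≡_ _≡_ (Inverse.from Fin.*↔× ∘ indices ∘ Inverse.to Fin.*↔×)
    encoded-injective eq =
      let eq′ = to-injective (↔-sym Fin.*↔×) eq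
      in to-injective Fin.*↔× (unique c≢d (Product.,-injectiveˡ eq′) (Product.,-injectiveʳ eq′))

-- The affine plane over a finite domain: class 0 holds the vertical lines, class 1 + m the lines of slope m.
module _ {K : 𝔽₂Algebra} (domain : IsDomain K) {q} (finite : Inverse (≡.setoid (Fin q)) (𝔽₂Algebra.setoid K)) where
  open 𝔽₂Algebra K
  open 𝔽₂AlgebraProperties K
  open DomainProperties K domain
  open FiniteDomainProperties K domain finite
  open Solver using (solve; _:+_; _:*_; _:=_)
  private
    ⟦_⟧ : Fin q → Carrier
    ⟦_⟧ = Inverse.to finite

    intercept : Fin q → Fin q × Fin q → Carrier
    intercept m (x , y) = ⟦ y ⟧ + ⟦ m ⟧ * ⟦ x ⟧

    index : Fin (suc q) → Fin q × Fin q → Fin q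
    index zero    (x , y) = x
    index (suc m) P       = Inverse.from finite (intercept m P)

    sameIntercept : ∀ m P Q → index (suc m) P ≡ index (suc m) Q → intercept m P + intercept m Q ≈ 0#
    sameIntercept m P Q eq = x≈y⇒x+y≈0 (index-injective eq)

    vertical : ∀ m {P Q} → proj₁ P ≡ proj₁ Q → index (suc m) P ≡ index (suc m) Q → P ≡ Q
    vertical m {x , y} {.x , y′} ≡.refl eq = ≡.cong (x ,_) (element-injective (x+y≈0⇒x≈y (trans
      (solve 3 (λ y y′ z → y :+ y′ := (y :+ z) :+ (y′ :+ z)) refl ⟦ y ⟧ ⟦ y′ ⟧ (⟦ m ⟧ * ⟦ x ⟧))
      (sameIntercept m (x , y) (x , y′) eq))))

    -- Adding the equations for the two slopes cancels the ordinates and leaves (m + n)(x + x′) = 0.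
    sameAbscissa : ∀ {m n} P Q → m ≢ n → index (suc m) P ≡ index (suc m) Q → index (suc n) P ≡ index (suc n) Q →
                   proj₁ P ≡ proj₁ Q
    sameAbscissa {m} {n} P@(x , y) Q@(x′ , y′) m≢n eqm eqn = element-injective
      (*-cancelˡ (m≢n ∘ element-injective ∘ x+y≈0⇒x≈y) (x+y≈0⇒x≈y (trans
        (solve 6 (λ m n x x′ y y′ → (m :+ n) :* x :+ (m :+ n) :* x′ :=
            ((y :+ m :* x) :+ (y′ :+ m :* x′)) :+ ((y :+ n :* x) :+ (y′ :+ n :* x′)))
          refl ⟦ m ⟧ ⟦ n ⟧ ⟦ x ⟧ ⟦ x′ ⟧ ⟦ y ⟧ ⟦ y′ ⟧)
        (trans (+-cong (sameIntercept m P Q eqm) (sameIntercept n P Q eqn)) (+-identityˡ 0#)))))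

    index-unique : ∀ {c d P Q} → c ≢ d → index c P ≡ index c Q → index d P ≡ index d Q → P ≡ Q
    index-unique {zero}  {zero}  c≢d _ _   = contradiction ≡.refl c≢d
    index-unique {zero}  {suc n} c≢d e f   = vertical n e f
    index-unique {suc m} {zero}  c≢d e f   = vertical m f e
    index-unique {suc m} {suc n} {P} {Q} c≢d e f = vertical m (sameAbscissa P Q (c≢d ∘ ≡.cong suc) e f) e

  affinePlane : AffinePlane q
  affinePlane = record { lineIndex = index ; unique = index-unique }

-- Graphs inserted into a parallel class

-- `noPath` forbids three consecutive edges without backtracking. The ends `a` and `d` may coincide,
-- so triangles are excluded along with longer paths, and every component is a star.
record StarForest (n : ℕ) : Set₁ where
  infix 4 _~_
  field
    _~_    : Rel (Fin n) 0ℓ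
    _~?_   : Decidable₂ _~_
    sym    : Symmetric _~_
    irrefl : Irreflexive _≡_ _~_
    noPath : ∀ {a b c d} → a ~ b → b ~ c → c ~ d → a ≢ c → b ≢ d → ⊥

data Star {n : ℕ} : Rel (Fin (suc n)) 0ℓ where
  outward : ∀ {b} → Star zero (suc b)
  inward  : ∀ {b} → Star (suc b) zero

star : ∀ n → StarForest (suc n)
star n = record
  { _~_    = Star
  ; _~?_   = λ where
      zero    zero    → no λ ()
      zero    (suc _) → yes outward
      (suc _) zero    → yes inward
      (suc _) (suc _) → no λ ()
  ; sym    = λ where
      outward → inward
      inward  → outward
  ; irrefl = λ { ≡.refl () }
  ; noPath = λ where
      outward inward  _       a≢c _   → a≢c ≡.refl
      inward  outward inward  _   b≢d → b≢d ≡.refl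
  }

starCentre-enumeration : ∀ {n} → Enumeration (Star {n} zero) n
starCentre-enumeration = record
  { member = suc ; injective = Fin.suc-injective ; sound = λ _ → outward ; complete = λ { (outward {b}) → b , ≡.refl } }

singleton-enumeration : ∀ {A : Set} {P : Pred A 0ℓ} {a} → P a → (∀ {x} → P x → a ≡ x) → Enumeration P 1
singleton-enumeration {a = a} pa only = record
  { member = λ _ → a ; injective = λ { {zero} {zero} _ → ≡.refl } ; sound = λ _ → pa ; complete = λ px → zero , only px }

starLeaf-enumeration : ∀ {n} {b : Fin n} → Enumeration (Star (suc b)) 1
starLeaf-enumeration = singleton-enumeration inward λ { inward → ≡.refl }

-- The edges are the orbits of the involution `opposite`; a second step always returns to the start,
-- which gives `noPath`.
matching : ∀ {n} → (∀ (b : Fin n) → opposite b ≢ b) → StarForest n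
matching moves = record
  { _~_    = λ a b → opposite a ≡ b
  ; _~?_   = λ a b → opposite a Fin.≟ b
  ; sym    = λ { {a} ≡.refl → Fin.opposite-involutive a }
  ; irrefl = λ { {a} ≡.refl eq → moves a eq }
  ; noPath = λ { {a} ≡.refl ≡.refl _ a≢c _ → a≢c (≡.sym (Fin.opposite-involutive a)) }
  }

-- A fixed point satisfies b = 2h - 1 - b, which would make 2h odd.
opposite-moves : ∀ h (b : Fin (2 ℕ.* h)) → opposite b ≢ b
opposite-moves h b fixed = ℕ.even≢odd h (toℕ b) (begin
  2 ℕ.* h                                       ≡⟨ ℕ.m+[n∸m]≡n (Fin.toℕ<n b) ⟨
  suc (toℕ b) ℕ.+ (2 ℕ.* h ℕ.∸ suc (toℕ b))     ≡⟨ ≡.cong (suc (toℕ b) ℕ.+_) (≡.trans (≡.sym (Fin.opposite-prop b)) (≡.cong toℕ fixed)) ⟩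
  suc (toℕ b ℕ.+ toℕ b)                         ≡⟨ ≡.cong (λ x → suc (toℕ b ℕ.+ x)) (ℕ.+-identityʳ (toℕ b)) ⟨
  suc (2 ℕ.* toℕ b)                             ∎)
  where open ≡.≡-Reasoning

module _ {n} {V : Set} (vertices : Fin n ↔ V) {_~_ : Rel V 0ℓ} (_~?_ : Decidable₂ _~_)
  (~-sym : Symmetric _~_) (~-irrefl : Irreflexive _≡_ _~_) where
  open Inverse vertices

  graphOn : Graph
  graphOn = record
    { order  = n
    ; _~_    = λ u v → to u ~ to v
    ; _~?_   = λ u v → to u ~? to v
    ; sym    = ~-sym
    ; irrefl = λ u≡v → ~-irrefl (≡.cong to u≡v)
    }

  ~-from : ∀ {x y} → x ~ y → to (from x) ~ to (from y)
  ~-from {x} {y} = ≡.subst₂ _~_ (≡.sym (strictlyInverseˡ x)) (≡.sym (strictlyInverseˡ y))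

  graphOn-degree≡ : ∀ v {k} → Enumeration (to v ~_) k → Graph.degree graphOn v ≡ k
  graphOn-degree≡ v = GraphProperties.degree≡ graphOn ∘ enumeration-preimage vertices

  graphOn-pentagon : ∀ {a b c d e} → a ~ b → b ~ c → c ~ d → d ~ e → e ~ a →
                     Unique (a ∷ b ∷ c ∷ d ∷ e ∷ []) → HasCycle graphOn 5
  graphOn-pentagon {a} {b} {c} {d} {e} ab bc cd de ea distinct = 4 , ≡.refl , record
    { 3≤length = s≤s (s≤s (s≤s z≤n))
    ; vertex   = from ∘ List.lookup (a ∷ b ∷ c ∷ d ∷ e ∷ [])
    ; distinct = lookup-injective distinct ∘ to-injective (↔-sym vertices)
    ; step     = λ where
        zero                   → ~-from ab
        (suc zero)             → ~-from bc
        (suc (suc zero))       → ~-from cd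
        (suc (suc (suc zero))) → ~-from de
    ; close    = ~-from ea
    }

-- Incidence graph with star forests on the parallel classes

module PlaneGraph {q} (plane : AffinePlane q) (forest : Fin (suc q) → StarForest q) where
  open AffinePlane plane
  private module F c = StarForest (forest c)

  Point Line V : Set
  Point = Fin q × Fin q
  Line = Fin (suc q) × Fin q
  V = Point ⊎ Line

  infix 4 _~_
  _~_ : Rel V 0ℓ
  inj₁ P       ~ inj₁ Q       = ⊥
  inj₁ P       ~ inj₂ (c , a) = lineIndex c P ≡ a
  inj₂ (c , a) ~ inj₁ P       = lineIndex c P ≡ a
  inj₂ (c , a) ~ inj₂ (d , b) = c ≡ d × F._~_ c a b

  _~?_ : Decidable₂ _~_
  inj₁ P       ~? inj₁ Q       = no λ ()
  inj₁ P       ~? inj₂ (c , a) = lineIndex c P Fin.≟ a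
  inj₂ (c , a) ~? inj₁ P       = lineIndex c P Fin.≟ a
  inj₂ (c , a) ~? inj₂ (d , b) = (c Fin.≟ d) ×-dec F._~?_ c a b

  ~-sym : Symmetric _~_
  ~-sym {inj₁ P} {inj₂ (c , a)} eq = eq
  ~-sym {inj₂ (c , a)} {inj₁ P} eq = eq
  ~-sym {inj₂ (c , a)} {inj₂ (.c , b)} (≡.refl , a~b) = ≡.refl , F.sym c a~b

  ~-irrefl : Irreflexive _≡_ _~_
  ~-irrefl {inj₂ (c , a)} ≡.refl (_ , a~a) = F.irrefl c ≡.refl a~a

  order : ℕ
  order = q ℕ.* q ℕ.+ suc q ℕ.* q

  opaque
    vertices : Fin order ↔ V
    vertices = ↔-trans Fin.+↔⊎ (Fin.*↔× ⊎-↔ Fin.*↔×)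

  graph : Graph
  graph = graphOn vertices _~?_ ~-sym ~-irrefl

  open Inverse vertices using (to)
  open GraphProperties graph using (5≤cycle)
  open Graph graph using (degree)

  -- Points are pairwise nonadjacent, so a triangle contains at most one. If it contains one, two
  -- parallel lines through it coincide; if none, `noPath` applies to the closed walk.
  triangleFree : ∀ {x y z} → x ~ y → y ~ z → z ~ x → ⊥
  triangleFree {inj₁ P} {inj₂ (c , a)} {inj₂ (.c , b)} e (≡.refl , a~b) f = F.irrefl c (≡.trans (≡.sym e) f) a~b
  triangleFree {inj₂ (c , a)} {inj₁ P} {inj₂ (.c , b)} e f (≡.refl , b~a) = F.irrefl c (≡.trans (≡.sym f) e) b~a
  triangleFree {inj₂ (c , a)} {inj₂ (.c , b)} {inj₁ P} (≡.refl , a~b) e f = F.irrefl c (≡.trans (≡.sym f) e) a~b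
  triangleFree {inj₂ (c , a)} {inj₂ (.c , b)} {inj₂ (.c , d)} (≡.refl , a~b) (≡.refl , b~d) (≡.refl , d~a) =
    F.noPath c a~b b~d d~a (λ { ≡.refl → F.irrefl c ≡.refl d~a }) (λ { ≡.refl → F.irrefl c ≡.refl a~b })

  noDigon : ∀ {P Q c d} → lineIndex c P ≡ lineIndex c Q → lineIndex d P ≡ lineIndex d Q →
            P ≢ Q → (c , lineIndex c P) ≢ (d , lineIndex d P) → ⊥
  noDigon {P} {Q} {c} {d} e f P≢Q L≢M with c Fin.≟ d
  ... | yes ≡.refl = L≢M ≡.refl
  ... | no  c≢d    = P≢Q (unique c≢d e f)

  -- Two points in a square are opposite and lie on two common lines, against `noDigon`. A single
  -- point lies on two lines of one class, which then coincide. Four lines belong to one class and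
  -- violate `noPath`.
  squareFree : ∀ {x y z w} → x ~ y → y ~ z → z ~ w → w ~ x → x ≢ z → y ≢ w → ⊥
  squareFree {inj₁ P} {inj₂ (c , a)} {inj₁ Q} {inj₂ (d , b)} ≡.refl e f ≡.refl P≢Q L≢M =
    noDigon (≡.sym e) (≡.sym f) (P≢Q ∘ ≡.cong inj₁) (L≢M ∘ ≡.cong inj₂)
  squareFree {inj₂ (c , a)} {inj₁ P} {inj₂ (d , b)} {inj₁ Q} ≡.refl ≡.refl e f L≢M P≢Q =
    noDigon (≡.sym f) (≡.sym e) (P≢Q ∘ ≡.cong inj₁) (L≢M ∘ ≡.cong inj₂)
  squareFree {inj₁ P} {inj₂ (c , a)} {inj₂ (.c , b)} {inj₂ (.c , d)} ≡.refl (≡.refl , _) (≡.refl , _) ≡.refl _ L≢M =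
    L≢M ≡.refl
  squareFree {inj₂ (c , a)} {inj₁ P} {inj₂ (.c , b)} {inj₂ (.c , d)} ≡.refl ≡.refl (≡.refl , _) (≡.refl , _) L≢M _ =
    L≢M ≡.refl
  squareFree {inj₂ (c , a)} {inj₂ (.c , b)} {inj₁ P} {inj₂ (.c , d)} (≡.refl , _) ≡.refl ≡.refl (≡.refl , _) _ L≢M =
    L≢M ≡.refl
  squareFree {inj₂ (c , a)} {inj₂ (.c , b)} {inj₂ (.c , d)} {inj₁ P} (≡.refl , _) (≡.refl , _) ≡.refl ≡.refl L≢M _ =
    L≢M ≡.refl
  squareFree {inj₂ (c , a)} {inj₂ (.c , b)} {inj₂ (.c , d)} {inj₂ (.c , e)} (≡.refl , a~b) (≡.refl , b~d) (≡.refl , d~e) _ a≢d b≢e =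
    F.noPath c a~b b~d d~e (a≢d ∘ ≡.cong (inj₂ ∘ (c ,_))) (b≢e ∘ ≡.cong (inj₂ ∘ (c ,_)))

  graph-5≤cycle : ∀ ℓ → HasCycle graph ℓ → 5 ≤ ℓ
  graph-5≤cycle = 5≤cycle triangleFree
    (λ uv vw wx xu u≢w v≢x → squareFree uv vw wx xu (u≢w ∘ to-injective vertices) (v≢x ∘ to-injective vertices))

  -- Two adjacent parallel lines together with two points on them that span a line of another class.
  graph-pentagon : ∀ {c d a b} → c ≢ d → F._~_ c a b → HasCycle graph 5
  graph-pentagon {c} {d} {a} {b} c≢d a~b =
    -- The second `a` picks the transversal in class `d`, an arbitrary choice among its lines.
    let P , P∈a , P∈d = meet c≢d a a
        Q , Q∈b , Q∈d = meet c≢d b a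
        a≢b = λ a≡b → F.irrefl c a≡b a~b
    in graphOn-pentagon vertices _~?_ ~-sym ~-irrefl
      {inj₂ (c , a)} {inj₂ (c , b)} {inj₁ Q} {inj₂ (d , a)} {inj₁ P} (≡.refl , a~b) Q∈b Q∈d P∈d P∈a
      ( ((λ { ≡.refl → a≢b ≡.refl }) ∷ (λ ()) ∷ (λ { ≡.refl → c≢d ≡.refl }) ∷ (λ ()) ∷ [])
      ∷ ((λ ()) ∷ (λ { ≡.refl → c≢d ≡.refl }) ∷ (λ ()) ∷ [])
      ∷ ((λ ()) ∷ (λ Q≡P → a≢b (≡.trans (≡.sym P∈a) (≡.trans (≡.cong (lineIndex c) (≡.sym (Sum.inj₁-injective Q≡P))) Q∈b))) ∷ [])
      ∷ ((λ ()) ∷ [])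
      ∷ [] ∷ [])

  point-degree : ∀ v {P} → to v ≡ inj₁ P → degree v ≡ suc q
  point-degree v {P} eq = graphOn-degree≡ vertices _~?_ ~-sym ~-irrefl v
    (≡.subst (λ x → Enumeration (x ~_) (suc q)) (≡.sym eq) (enumeration-⊎ noPoints linesThrough))
    where
    noPoints : Enumeration (λ (Q : Point) → ⊥) 0
    noPoints = record { member = λ () ; injective = λ { {()} } ; sound = λ () ; complete = λ () }
    linesThrough : Enumeration (λ ((c , a) : Line) → lineIndex c P ≡ a) (suc q)
    linesThrough = record
      { member    = λ c → c , lineIndex c P
      ; injective = Product.,-injectiveˡ
      ; sound     = λ _ → ≡.refl
      ; complete  = λ { ≡.refl → _ , ≡.refl }
      }

  -- A line meets each of the `q` lines of another class exactly once, so that class labels its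
  -- points.
  pointsOn-enumeration : ∀ {c d} → c ≢ d → ∀ a → Enumeration (λ P → lineIndex c P ≡ a) q
  pointsOn-enumeration {c} {d} c≢d a = record
    { member    = λ b → proj₁ (meet c≢d a b)
    ; injective = λ {b} {b′} eq → ≡.trans (≡.sym (proj₂ (proj₂ (meet c≢d a b))))
        (≡.trans (≡.cong (lineIndex d) eq) (proj₂ (proj₂ (meet c≢d a b′))))
    ; sound     = λ b → proj₁ (proj₂ (meet c≢d a b))
    ; complete  = λ {P} P∈a → let _ , Q∈a , Q∈d = meet c≢d a (lineIndex d P) in
        lineIndex d P , unique c≢d (≡.trans Q∈a (≡.sym P∈a)) Q∈d
    }

  line-degree : ∀ v {c a d k} → c ≢ d → to v ≡ inj₂ (c , a) → Enumeration (F._~_ c a) k → degree v ≡ q ℕ.+ k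
  line-degree v {c} {a} {d} {k} c≢d eq E = graphOn-degree≡ vertices _~?_ ~-sym ~-irrefl v
    (≡.subst (λ x → Enumeration (x ~_) (q ℕ.+ k)) (≡.sym eq) (enumeration-⊎ (pointsOn-enumeration c≢d a) parallels))
    where
    parallels : Enumeration (λ ((d , b) : Line) → c ≡ d × F._~_ c a b) k
    parallels = record
      { member    = λ i → c , member E i
      ; injective = injective E ∘ Product.,-injectiveʳ
      ; sound     = λ i → ≡.refl , sound E i
      ; complete  = λ { (≡.refl , a~b) → let i , eq = complete E a~b in i , ≡.cong (c ,_) eq }
      }

-- The family of cages

open import Data.Nat.Base using (_+_; _*_; _∸_; _^_)
open Polynomials using (finiteDomain; 2≤2^[1+n])

-- The plane has order q = 3 + k. Classes 0, …, i carry stars, whose centres have degree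
-- q + (q - 1) = 2 r - 3 for r = q + 1; all other vertices have degree q + 1.
module StarredPlane {k} (plane : AffinePlane (3 + k)) (moves : ∀ (b : Fin (3 + k)) → opposite b ≢ b)
  (i : Fin (4 + k)) where
  q r m : ℕ
  q = 3 + k
  r = suc q
  m = q + (2 + k)

  forest : Fin (suc q) → StarForest q
  forest c with toℕ c ℕ.≤? toℕ i
  ... | yes _ = star (2 + k)
  ... | no  _ = matching moves

  open PlaneGraph plane forest public
  open Inverse vertices using (to; from; strictlyInverseˡ)
  open Graph graph using (degree)

  IsCentre : V → Set
  IsCentre x = ∃[ c ] (toℕ c ≤ toℕ i × x ≡ inj₂ (c , zero))

  -- Repeating the case distinction made in `forest` lets `forest c` reduce to a star or a matching.
  parallels : ∀ c a → (IsCentre (inj₂ (c , a)) × Enumeration (StarForest._~_ (forest c) a) (2 + k))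
                    ⊎ (¬ IsCentre (inj₂ (c , a)) × Enumeration (StarForest._~_ (forest c) a) 1)
  parallels c a with toℕ c ℕ.≤? toℕ i
  parallels c zero    | yes c≤i = inj₁ ((c , c≤i , ≡.refl) , starCentre-enumeration)
  parallels c (suc a) | yes c≤i = inj₂ ((λ { (_ , _ , ()) }) , starLeaf-enumeration)
  parallels c a       | no  c≰i = inj₂ ((λ { (_ , c≤i , ≡.refl) → c≰i c≤i }) , singleton-enumeration ≡.refl id)

  otherClass : ∀ (c : Fin (suc q)) → ∃[ d ] c ≢ d
  otherClass zero    = suc zero , λ ()
  otherClass (suc c) = zero , λ ()

  graph-degree : ∀ v → (IsCentre (to v) × degree v ≡ m) ⊎ (¬ IsCentre (to v) × degree v ≡ r)
  graph-degree v = go (to v) ≡.refl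
    where
    go : ∀ x → to v ≡ x → (IsCentre x × degree v ≡ m) ⊎ (¬ IsCentre x × degree v ≡ r)
    go (inj₁ P)       eq = inj₂ ((λ ()) , point-degree v eq)
    go (inj₂ (c , a)) eq = Sum.map
      (λ (centre , E) → centre , line-degree v (proj₂ (otherClass c)) eq E)
      (λ (¬centre , E) → ¬centre , ≡.trans (line-degree v (proj₂ (otherClass c)) eq E) (ℕ.+-comm q 1))
      (parallels c a)

  -- This compares q + 1 with q + (q - 1), so it expresses q > 2; the offset 3 in `q` provides it.
  r<m : r < m
  r<m = s≤s (s≤s (s≤s (ℕ.≤-trans (ℕ.≤-reflexive (ℕ.+-comm 2 k)) (ℕ.+-monoʳ-≤ k (ℕ.m≤m+n 2 k)))))

  degree≡m⇒isCentre : ∀ v → degree v ≡ m → IsCentre (to v)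
  degree≡m⇒isCentre v eq with graph-degree v
  ... | inj₁ (centre , _) = centre
  ... | inj₂ (_ , eq′)    = contradiction (≡.trans (≡.sym eq′) eq) (ℕ.<⇒≢ r<m)

  isCentre⇒degree≡m : ∀ v → IsCentre (to v) → degree v ≡ m
  isCentre⇒degree≡m v centre with graph-degree v
  ... | inj₁ (_ , eq)      = eq
  ... | inj₂ (¬centre , _) = contradiction centre ¬centre

  -- There is one centre in each of the classes 0, ..., `i`, hence at least one, so the degree `m`
  -- does occur.
  centres : Enumeration IsCentre (suc (toℕ i))
  centres = record
    { member    = λ j → inj₂ (inject≤ j i<n , zero)
    ; injective = Fin.inject≤-injective i<n i<n _ _ ∘ Product.,-injectiveˡ ∘ Sum.inj₂-injective
    ; sound     = λ j → inject≤ j i<n , ≡.subst (_≤ toℕ i) (≡.sym (Fin.toℕ-inject≤ j i<n)) (ℕ.s≤s⁻¹ (Fin.toℕ<n j)) , ≡.refl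
    ; complete  = λ { (c , c≤i , ≡.refl) → fromℕ< (s≤s c≤i) , ≡.cong (λ c → inj₂ (c , zero)) (Fin.toℕ-injective
        (≡.trans (Fin.toℕ-inject≤ _ i<n) (Fin.toℕ-fromℕ< (s≤s c≤i)))) }
    }
    where
    i<n : toℕ i < suc q
    i<n = Fin.toℕ<n i

  degree≡m-enumeration : Enumeration (λ v → degree v ≡ m) (suc (toℕ i))
  degree≡m-enumeration = record
    { member    = member E ; injective = injective E
    ; sound     = λ j → isCentre⇒degree≡m _ (sound E j)
    ; complete  = λ {v} → complete E {v} ∘ degree≡m⇒isCentre v }
    where E = enumeration-preimage vertices centres

  degreeSet : DegreeSetIs graph r m
  degreeSet d = mk⇔
    (λ { (v , ≡.refl) → Sum.swap (Sum.map proj₂ proj₂ (graph-degree v)) })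
    [ (λ { ≡.refl → from (inj₁ (zero , zero)) , point-degree (from (inj₁ (zero , zero))) (strictlyInverseˡ _) })
    , (λ { ≡.refl → member degree≡m-enumeration zero , sound degree≡m-enumeration zero }) ]′

  biregular : IsBiregular r m 5 graph
  biregular = (graph-pentagon {zero} {suc zero} {zero} {suc zero} (λ ()) outward , graph-5≤cycle) , degreeSet

  order≡ : order ≡ suc (m * r)
  order≡ = solve 1 (λ k → let q = con 3 :+ k in
    q :* q :+ (con 1 :+ q) :* q := con 1 :+ (q :+ (con 2 :+ k)) :* (con 1 :+ q)) ≡.refl k
    where open +-*-Solver using (solve; con; _:+_; _:*_; _:=_)

  cage : IsCage r m 5 graph
  cage = biregular , λ H H-biregular →
    ≡.subst (_≤ Graph.order H) (≡.sym order≡) (biregular⇒order> H (ℕ.<⇒≤ r<m) H-biregular)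

  m≡2r∸3 : m ≡ 2 * r ∸ 3
  -- As `r` is 4 + k, the truncated subtraction computes, leaving the sum on the right.
  m≡2r∸3 = solve 1 (λ k → con 3 :+ k :+ (con 2 :+ k) := con 1 :+ k :+ (con 4 :+ k :+ con 0)) ≡.refl k
    where open +-*-Solver using (solve; con; _:+_; _:=_)

-- With `q` and `r` as variables, the equations can be matched away, which brings a power of 2 into
-- the form `3 + k`.
cagesFromPlane : ∀ {k q r} → q ≡ 3 + k → r ≡ suc q → AffinePlane q → (∀ (b : Fin q) → opposite b ≢ b) →
  Σ (Fin r → Graph) λ C → (∀ i → IsCage r (2 * r ∸ 3) 5 (C i)) × (∀ i j → i ≢ j → ¬ Isomorphism (C i) (C j))
cagesFromPlane {k} ≡.refl ≡.refl plane moves = graph ,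
  (λ i → ≡.subst (λ m → IsCage (r i) m 5 (graph i)) (m≡2r∸3 i) (cage i)) ,
  (λ i j i≢j φ → i≢j (Fin.toℕ-injective (ℕ.suc-injective
    (#verticesOfDegree-isomorphism (m i) φ (degree≡m-enumeration i) (degree≡m-enumeration j)))))
  where open module Plane = StarredPlane {k} plane moves

theorem3p3 : ∀ (s q r : ℕ) → 2 ≤ s → q ≡ 2 ^ s → r ≡ q + 1 →
    Σ (Fin (q + 1) → Graph) λ C →
    (∀ i → IsCage r (2 * r ∸ 3) 5 (C i)) ×
    (∀ i j → i ≢ j → ¬ Isomorphism (C i) (C j))
theorem3p3 (suc zero) q r (s≤s ()) _ _
theorem3p3 (suc (suc t)) q r 2≤s ≡.refl ≡.refl =
  -- The argument of `finiteDomain` is one less than the exponent. Since `2 ^ suc (suc t)` unfolds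
  -- to `2 * 2 ^ suc t`, half the order is `2 ^ suc t`, as `opposite-moves` expects.
  let K , domain , finite = finiteDomain (suc t)
      k , 3+k≡q = ℕ.m≤n⇒∃[o]m+o≡n {3} 3≤q
  in cagesFromPlane (≡.sym 3+k≡q) (ℕ.+-comm q 1) (affinePlane domain finite) (opposite-moves (2 ^ suc t))
  where
  3≤q : 3 ≤ 2 ^ suc (suc t)
  3≤q = ℕ.≤-trans (ℕ.n≤1+n 3) (ℕ.*-monoʳ-≤ 2 (2≤2^[1+n] t))
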